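{- Let $\mathbb K$ be a computable age, and let $\mathrm{AB}$ be the collection of all embeddings between elements of $\mathbb K$ whose codomain is some amalgamation base in $\mathbb K$. Let $\mathscr{EI}(\mathbb K)''$ denote the double Turing jump of the embedding information $\mathscr{EI}(\mathbb K)$. Then (a) the Turing degree of $\mathrm{AB}$ is $\leq_{\mathrm T}\mathscr{EI}(\mathbb K)''$, and (b) when $\mathbb K$ has the cofinal amalgamation property (CAP), it has the $\mathscr{EI}(\mathbb K)''$-computable cofinal amalgamation property $\mathscr{EI}(\mathbb K)''$-(cCAP).
   Context: Languages and structures. $\mathcal{L}$ is a countable language (relation symbols of positive arity; function symbols of any arity, 0-ary ones being constants) with a computable representation: relation symbols $R_n$ and function symbols $F_m$ are indexed bijectively by disjoint computable subsets of $\omega$, with arity computable from the index. An $\mathcal{L}$-structure $\mathcal{M}$ is c.e. if its underlying set $M$ is a c.e. subset of $\omega$ and the sets $\{(n,\mathbf a): \mathcal M\models R_n(\mathbf a)\}$, $\{(n,\mathbf a): \mathcal M\models \neg R_n(\mathbf a)\}$, $\{(m,\mathbf a,b): \mathcal M\models F_m(\mathbf a)=b\}$ are c.e.; it is computable if moreover $M$ is computable. Tuples are finite; $\mathrm{cl}_{\mathcal M}(\mathbf a)$ is the smallest substructure of $\mathcal M$ containing $\mathbf a$. For $\mathbf a\in\mathcal A$, $\mathbf b\in\mathcal B$ of the same length, $\mathbf a\simeq\mathbf b$ means that for every atomic $\mathcal L$-formula $\varphi$, $\mathcal A\models\varphi(\mathbf a)$ iff $\mathcal B\models\varphi(\mathbf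 b)$; equivalently $\mathbf a\mapsto\mathbf b$ extends to an isomorphism $\mathrm{cl}(\mathbf a)\to\mathrm{cl}(\mathbf b)$. Ages. An age is a collection of finitely generated $\mathcal L$-structures closed under isomorphism. A computable age (computable representation of an age $\mathcal K$) is a c.e. set $\mathbb K$ of triples $(\mathbf a,\mathcal A,i)$ (computable structures being given by indices), with exactly one triple for each $i\in\omega$, written $\mathbb I(i)=(\mathbf a_i,\mathcal A_i,i)$, such that each $\mathcal A_i$ is a computable $\mathcal L$-structure in $\mathcal K$ with $\mathcal A_i=\mathrm{cl}_{\mathcal A_i}(\mathbf a_i)$, and every $\mathcal B\in\mathcal K$ is isomorphic to some $\mathcal A_i$. $\mathbb K$ is said to have a property of ages if $\mathcal K$ does. The embedding information $\mathscr{EI}(\mathbb K)$ is the set of tuples $(\mathbb I(k_0),\mathbf b_0,\mathbb I(k_1),\mathbf b_1)$ with $\mathbf b_0\in\mathcal A_{k_0}$, $\mathbf b_1\in\mathcal A_{k_1}$ and $\mathbf b_0\simeq\mathbf b_1$. Embeddings and amalgamation diagrams. A potential embedding in $\mathbb K$ is a triple $F=(\mathbb I(i),\mathbb I(j),\mathbf c)$ with $\mathbf c\in\mathcal A_j$; $\mathrm{dom}(F)=\mathbb I(i)$, $\mathrm{codom}(F)=\mathbb I(j)$, $\mathrm{range}(F)=\mathbf c$. It is an embedding if $\mathbf a_i\simeq\mathbf c$ (it then encodes the embedding $\mathcal A_i\to\mathcal A_j$ sending $\mathbf a_i$ to $\mathbf c$); composition of embeddings is composition of the encoded maps, and an isomorphism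 is an embedding whose encoded map is onto. A potential span is a pair $(F_0,F_1)$ of potential embeddings with $\mathrm{dom}(F_0)=\mathrm{dom}(F_1)$; it is a span if both are embeddings. An amalgamation diagram over a potential span $(F_0,F_1)$ is a pair $(G_0,G_1)$ with $G_0$ an embedding, $G_1$ a potential embedding, $\mathrm{dom}(G_i)=\mathrm{codom}(F_i)$ for $i\in\{0,1\}$, $\mathrm{codom}(G_0)=\mathrm{codom}(G_1)$, and such that if $(F_0,F_1)$ is a span then $G_1$ is an embedding and $G_0\circ F_0=G_1\circ F_1$. Cofinal amalgamation. An amalgamation base is an $\mathcal A'\in\mathcal K$ such that whenever $\mathcal B,\mathcal C\in\mathcal K$ and $f_{\mathcal B}:\mathcal A'\to\mathcal B$, $f_{\mathcal C}:\mathcal A'\to\mathcal C$ are embeddings, there are $\mathcal D\in\mathcal K$ and embeddings $\alpha_{\mathcal B}:\mathcal B\to\mathcal D$, $\alpha_{\mathcal C}:\mathcal C\to\mathcal D$ with $\alpha_{\mathcal B}\circ f_{\mathcal B}=\alpha_{\mathcal C}\circ f_{\mathcal C}$. (CAP): every $\mathcal A\in\mathcal K$ embeds into some amalgamation base in $\mathcal K$. A collection of distinguished extensions is a collection of embeddings in $\mathbb K$ closed under pre- and post-composition with isomorphisms between elements of $\mathbb K$ and such that every $\mathbb I(i)$ is the domain of some member. A witness to (CAP) is a pair $(\mathrm{AB}_0,f)$ where $\mathrm{AB}_0$ is a collection of distinguished extensions each of whose members has an amalgamation base as codomain, and $f$ takes each tuple $(F,G_0,G_1)$ with $F\in\mathrm{AB}_0$,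 $(G_0,G_1)$ a potential span and $\mathrm{dom}(G_0)=\mathrm{dom}(G_1)=\mathrm{codom}(F)$ to an amalgamation diagram over $(G_0,G_1)$. For a Turing degree $\mathfrak s$, it is $\mathfrak s$-computable if $\mathrm{AB}_0$ is $\mathfrak s$-c.e. and $f$ is an $\mathfrak s$-computable partial function. $\mathbb K$ has $\mathfrak s$-(cCAP) if it has an $\mathfrak s$-computable witness to (CAP). -}

module Defs where

open import Level using (Level; 0ℓ) renaming (suc to lsuc)
open import Data.Nat.Base using (ℕ; zero; suc; _+_; _<_)
open import Data.Nat.Properties using (+-suc; +-comm; +-identityʳ; suc-injective)
open import Data.Fin.Base using (Fin)
open import Data.Vec.Base using (Vec; []; _∷_; lookup; map)
open import Data.Vec.Properties using (tabulate-cong; tabulate∘lookup; lookup-map)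
open import Data.Vec.Relation.Unary.All using (All; []; _∷_)
open import Data.Product.Base using (Σ; ∃; ∃-syntax; Σ-syntax; _×_; _,_; proj₁; proj₂)
open import Data.Refinement.Base using (Refinement; Refinement-syntax)
open import Function.Base using (_∘_)
open import Function.Bundles using (_⇔_; mk⇔; Equivalence)
open import Function.Definitions using (Injective; Surjective)
open import Relation.Nullary.Negation.Core using (¬_)
open import Relation.Unary using (Pred; ∅)
open import Relation.Binary.PropositionalEquality

open Refinement using (value)

triangle : ℕ → ℕ
triangle zero    = zero
triangle (suc n) = suc n + triangle n

-- The Cantor pairing function.
infixr 6 _⊗_
_⊗_ : ℕ → ℕ → ℕ
a ⊗ b = triangle (a + b) + b

next : ℕ × ℕ → ℕ × ℕ
next (zero  , b) = suc b , 0
next (suc a , b) = a , suc b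

-- The inverse of _⊗_, walking along the antidiagonals.
unpair : ℕ → ℕ × ℕ
unpair zero    = 0 , 0
unpair (suc n) = next (unpair n)

⊗-row : ∀ a → suc a ⊗ 0 ≡ suc (0 ⊗ a)
⊗-row a rewrite +-identityʳ a | +-identityʳ (a + triangle a) = cong suc (+-comm a (triangle a))

⊗-diagonal : ∀ a b → a ⊗ suc b ≡ suc (suc a ⊗ b)
⊗-diagonal a b rewrite +-suc a b = +-suc (triangle (suc (a + b))) b

unpair-⊗ : ∀ a b → unpair (a ⊗ b) ≡ (a , b)
unpair-⊗ a b = go (a + b) a b refl
  where
  go : ∀ s a b → a + b ≡ s → unpair (a ⊗ b) ≡ (a , b)
  go s       zero    zero    _ = refl
  go (suc s) (suc a) zero    p =
    trans (cong unpair (⊗-row a))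
      (cong next (go s 0 a (trans (sym (+-identityʳ a)) (suc-injective p))))
  go s       a       (suc b) p =
    trans (cong unpair (⊗-diagonal a b))
      (cong next (go s (suc a) b (trans (sym (+-suc a b)) p)))

tuple : ∀ {n} → Vec ℕ n → ℕ
tuple []       = 0
tuple (x ∷ xs) = suc (x ⊗ tuple xs)

data Code : Set where
  zeroᶜ sucᶜ fstᶜ sndᶜ oracleᶜ : Code
  pairᶜ compᶜ precᶜ            : Code → Code → Code
  μᶜ                           : Code → Code

⌜_⌝ : Code → ℕ
⌜ zeroᶜ ⌝     = 0 ⊗ 0
⌜ sucᶜ ⌝      = 1 ⊗ 0
⌜ fstᶜ ⌝      = 2 ⊗ 0
⌜ sndᶜ ⌝      = 3 ⊗ 0
⌜ oracleᶜ ⌝   = 4 ⊗ 0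
⌜ pairᶜ c d ⌝ = 5 ⊗ ⌜ c ⌝ ⊗ ⌜ d ⌝
⌜ compᶜ c d ⌝ = 6 ⊗ ⌜ c ⌝ ⊗ ⌜ d ⌝
⌜ precᶜ c d ⌝ = 7 ⊗ ⌜ c ⌝ ⊗ ⌜ d ⌝
⌜ μᶜ c ⌝      = 8 ⊗ ⌜ c ⌝

-- O ⊢ c · n ↓ v : with oracle O, the program c halts on input n with output v.
infix 4 _⊢_·_↓_
data _⊢_·_↓_ (O : Pred ℕ 0ℓ) : Code → ℕ → ℕ → Set where
  zero↓  : ∀ {n} → O ⊢ zeroᶜ · n ↓ 0
  suc↓   : ∀ {n} → O ⊢ sucᶜ · n ↓ suc n
  fst↓   : ∀ {n} → O ⊢ fstᶜ · n ↓ proj₁ (unpair n)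
  snd↓   : ∀ {n} → O ⊢ sndᶜ · n ↓ proj₂ (unpair n)
  yes↓   : ∀ {n} → O n → O ⊢ oracleᶜ · n ↓ 1
  no↓    : ∀ {n} → ¬ O n → O ⊢ oracleᶜ · n ↓ 0
  pair↓  : ∀ {c d n u v} → O ⊢ c · n ↓ u → O ⊢ d · n ↓ v → O ⊢ pairᶜ c d · n ↓ u ⊗ v
  comp↓  : ∀ {c d n u v} → O ⊢ d · n ↓ u → O ⊢ c · u ↓ v → O ⊢ compᶜ c d · n ↓ v
  prec₀↓ : ∀ {c d n a v} → unpair n ≡ (a , 0) →
           O ⊢ c · a ↓ v → O ⊢ precᶜ c d · n ↓ v
  prec₊↓ : ∀ {c d n a k u v} → unpair n ≡ (a , suc k) →
           O ⊢ precᶜ c d · (a ⊗ k) ↓ u → O ⊢ d · (a ⊗ k ⊗ u) ↓ v →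
           O ⊢ precᶜ c d · n ↓ v
  μ↓     : ∀ {c n k} → O ⊢ c · (n ⊗ k) ↓ 0 →
           (∀ j → j < k → ∃[ u ] O ⊢ c · (n ⊗ j) ↓ suc u) →
           O ⊢ μᶜ c · n ↓ k

module _ {ℓ : Level} where

  Enumerates : Pred ℕ 0ℓ → Code → Pred ℕ ℓ → Set ℓ
  Enumerates O c A = ∀ n → A n ⇔ (∃[ v ] O ⊢ c · n ↓ v)

  Decides : Pred ℕ 0ℓ → Code → Pred ℕ ℓ → Set ℓ
  Decides O c A = ∀ n → (A n → O ⊢ c · n ↓ 1) × (¬ A n → O ⊢ c · n ↓ 0)

  CE-in : Pred ℕ 0ℓ → Pred ℕ ℓ → Set ℓ
  CE-in O A = ∃[ c ] Enumerates O c A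

  infix 4 _≤T_
  _≤T_ : Pred ℕ ℓ → Pred ℕ 0ℓ → Set ℓ
  A ≤T O = ∃[ c ] Decides O c A

-- Unrelativised computability is computability with the empty oracle.
CE : Pred ℕ 0ℓ → Set
CE = CE-in ∅

Computable : Pred ℕ 0ℓ → Set
Computable A = A ≤T ∅

infix 8 _′
_′ : Pred ℕ 0ℓ → Pred ℕ 0ℓ
(O ′) e = ∃[ c ] (⌜ c ⌝ ≡ e × ∃[ v ] O ⊢ c · e ↓ v)

record PartialFunction : Set₁ where
  field
    graph      : ℕ → ℕ → Set
    functional : ∀ {n u v} → graph n u → graph n v → u ≡ v

PartialComputable-in : Pred ℕ 0ℓ → PartialFunction → Set
PartialComputable-in O f = ∃[ c ] (∀ n v → PartialFunction.graph f n v ⇔ O ⊢ c · n ↓ v)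

record Language : Set₁ where
  field
    Rel Fun   : Set
    relArity  : Rel → ℕ
    funArity  : Fun → ℕ
    relArity-positive : ∀ R → 0 < relArity R

    relIndex  : Rel → ℕ
    funIndex  : Fun → ℕ
    relIndex-injective : Injective _≡_ _≡_ relIndex
    funIndex-injective : Injective _≡_ _≡_ funIndex
    index-disjoint     : ∀ R F → relIndex R ≢ funIndex F
    relIndex-computable : Computable (λ n → ∃[ R ] relIndex R ≡ n)
    funIndex-computable : Computable (λ n → ∃[ F ] funIndex F ≡ n)
    relArity-computable : ∃[ c ] (∀ R → ∅ ⊢ c · relIndex R ↓ relArity R)
    funArity-computable : ∃[ c ] (∀ F → ∅ ⊢ c · funIndex F ↓ funArity F)

module _ (L : Language) where
  open Language L

  record Interpretation (X : Set) : Set₁ where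
    field
      rel : (R : Rel) → Vec X (relArity R) → Set
      fun : (F : Fun) → Vec X (funArity F) → X

  record Structure : Set₁ where
    field
      Carrier        : Set
      interpretation : Interpretation Carrier
    open Interpretation interpretation public

  -- Structures whose underlying set is a subset of ω.  Membership is
  -- irrelevant, so that two elements are equal as soon as their values are.
  record ωStructure : Set₁ where
    field
      Dom            : Pred ℕ 0ℓ
      interpretation : Interpretation [ n ∈ ℕ ∣ Dom n ]
    Element : Set
    Element = [ n ∈ ℕ ∣ Dom n ]
    open Interpretation interpretation public

    structure : Structure
    structure = record { interpretation = interpretation }

  data Term (n : ℕ) : Set where
    var : Fin n → Term n
    app : (F : Fun) → Vec (Term n) (funArity F) → Term n

  data AtomicFormula (n : ℕ) : Set where
    _≐_  : Term n → Term n → AtomicFormula n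
    relᶠ : (R : Rel) → Vec (Term n) (relArity R) → AtomicFormula n

module _ {L : Language} where
  open Language L
  open Structure

  module _ (A : Structure L) where

    eval  : ∀ {n} → Vec (Carrier A) n → Term L n → Carrier A
    evals : ∀ {n m} → Vec (Carrier A) n → Vec (Term L n) m → Vec (Carrier A) m
    eval  a (var k)    = lookup a k
    eval  a (app F ts) = fun A F (evals a ts)
    evals a []         = []
    evals a (t ∷ ts)   = eval a t ∷ evals a ts

    Satisfies : ∀ {n} → Vec (Carrier A) n → AtomicFormula L n → Set
    Satisfies a (t ≐ s)     = eval a t ≡ eval a s
    Satisfies a (relᶠ R ts) = rel A R (evals a ts)

    -- The smallest substructure containing a.
    data Cl {n} (a : Vec (Carrier A) n) : Carrier A → Set where
      gen : ∀ k → Cl a (lookup a k)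
      app : ∀ F {xs} → All (Cl a) xs → Cl a (fun A F xs)

    GeneratedBy : ∀ {n} → Vec (Carrier A) n → Set
    GeneratedBy a = ∀ x → Cl a x

    FinitelyGenerated : Set
    FinitelyGenerated = ∃[ n ] Σ[ a ∈ Vec (Carrier A) n ] GeneratedBy a

  SameAtomicType : (A B : Structure L) {n : ℕ} → Vec (Carrier A) n → Vec (Carrier B) n → Set
  SameAtomicType A B a b = ∀ φ → Satisfies A a φ ⇔ Satisfies B b φ

  record Embedding (A B : Structure L) : Set where
    field
      to        : Carrier A → Carrier B
      injective : Injective _≡_ _≡_ to
      fun-hom   : ∀ F xs → to (fun A F xs) ≡ fun B F (map to xs)
      rel-hom   : ∀ R xs → rel A R xs ⇔ rel B R (map to xs)

  open Embedding

  IsIsomorphism : {A B : Structure L} → Embedding A B → Set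
  IsIsomorphism g = Surjective _≡_ _≡_ (to g)

  _≅_ : Structure L → Structure L → Set
  A ≅ B = Σ[ g ∈ Embedding A B ] IsIsomorphism g

  module _ {A : Structure L} {n : ℕ} {a : Vec (Carrier A) n} where

    term  : ∀ {x} → Cl A a x → Term L n
    terms : ∀ {m} {xs : Vec (Carrier A) m} → All (Cl A a) xs → Vec (Term L n) m
    term  (gen k)    = var k
    term  (app F ps) = app F (terms ps)
    terms []         = []
    terms (p ∷ ps)   = term p ∷ terms ps

    eval-term   : ∀ {x} (p : Cl A a x) → eval A a (term p) ≡ x
    evals-terms : ∀ {m} {xs : Vec (Carrier A) m} (ps : All (Cl A a) xs) →
                  evals A a (terms ps) ≡ xs
    eval-term   (gen k)    = refl
    eval-term   (app F ps) = cong (fun A F) (evals-terms ps)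
    evals-terms []         = refl
    evals-terms (p ∷ ps)   = cong₂ _∷_ (eval-term p) (evals-terms ps)

  module _ {A B : Structure L} (g : Embedding A B) {n : ℕ} (a : Vec (Carrier A) n) where

    to-eval  : ∀ t → to g (eval A a t) ≡ eval B (map (to g) a) t
    to-evals : ∀ {m} (ts : Vec (Term L n) m) →
               map (to g) (evals A a ts) ≡ evals B (map (to g) a) ts
    to-eval  (var k)    = sym (lookup-map k (to g) a)
    to-eval  (app F ts) = trans (fun-hom g F (evals A a ts)) (cong (fun B F) (to-evals ts))
    to-evals []         = refl
    to-evals (t ∷ ts)   = cong₂ _∷_ (to-eval t) (to-evals ts)

    embedding-preserves-type : SameAtomicType A B a (map (to g) a)
    embedding-preserves-type (t ≐ s) = mk⇔
      (λ e → trans (sym (to-eval t)) (trans (cong (to g) e) (to-eval s)))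
      (λ e → injective g (trans (to-eval t) (trans e (sym (to-eval s)))))
    embedding-preserves-type (relᶠ R ts) =
      subst (λ xs → rel A R (evals A a ts) ⇔ rel B R xs) (to-evals ts) (rel-hom g R (evals A a ts))

  -- If a generates A and c has the same atomic type, then a ↦ c extends to an embedding of A.
  module _ {A B : Structure L} {n : ℕ} {a : Vec (Carrier A) n} {c : Vec (Carrier B) n}
           (generated : GeneratedBy A a) (a≃c : SameAtomicType A B a c) where

    private
      τ : Carrier A → Term L n
      τ x = term (generated x)

      τs : ∀ {m} → Vec (Carrier A) m → Vec (Term L n) m
      τs []       = []
      τs (x ∷ xs) = τ x ∷ τs xs

      eval-τs : ∀ {m} (xs : Vec (Carrier A) m) → evals A a (τs xs) ≡ xs
      eval-τs []       = refl
      eval-τs (x ∷ xs) = cong₂ _∷_ (eval-term (generated x)) (eval-τs xs)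

      h : Carrier A → Carrier B
      h x = eval B c (τ x)

      evals-h : ∀ {m} (xs : Vec (Carrier A) m) → evals B c (τs xs) ≡ map h xs
      evals-h []       = refl
      evals-h (x ∷ xs) = cong (h x ∷_) (evals-h xs)

      h-eval : ∀ t → h (eval A a t) ≡ eval B c t
      h-eval t = Equivalence.to (a≃c (τ (eval A a t) ≐ t)) (eval-term (generated (eval A a t)))

    extend : Embedding A B
    extend .to = h
    extend .injective {x} {y} e =
      trans (sym (eval-term (generated x)))
        (trans (Equivalence.from (a≃c (τ x ≐ τ y)) e) (eval-term (generated y)))
    extend .fun-hom F xs =
      trans (cong (h ∘ fun A F) (sym (eval-τs xs)))
        (trans (h-eval (app F (τs xs))) (cong (fun B F) (evals-h xs)))
    extend .rel-hom R xs =
      subst₂ (λ us vs → rel A R us ⇔ rel B R vs) (eval-τs xs) (evals-h xs) (a≃c (relᶠ R (τs xs)))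

    extend-generators : map (to extend) a ≡ c
    extend-generators =
      trans (sym (tabulate∘lookup (map h a)))
        (trans (tabulate-cong (λ k → trans (lookup-map k h a) (h-eval (var k))))
               (tabulate∘lookup c))

  module _ (𝓜 : ωStructure L) where
    open ωStructure 𝓜 using (Dom; Element)
      renaming (rel to relᴹ; fun to funᴹ)

    tupleᴹ : ∀ {n} → Vec Element n → ℕ
    tupleᴹ a = tuple (map value a)

    PositiveDiagram NegativeDiagram FunctionGraph : Pred ℕ 0ℓ
    PositiveDiagram n = ∃[ R ] ∃[ a ] (relᴹ R a × relIndex R ⊗ tupleᴹ a ≡ n)
    NegativeDiagram n = ∃[ R ] ∃[ a ] (¬ relᴹ R a × relIndex R ⊗ tupleᴹ a ≡ n)
    FunctionGraph   n = ∃[ F ] ∃[ a ] funIndex F ⊗ tupleᴹ a ⊗ value (funᴹ F a) ≡ n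

    -- An index packages a decision procedure for the underlying set with c.e.
    -- indices for the diagrams, following the definition of a c.e. structure.
    record IsIndex (e : ℕ) : Set where
      field
        c₀ c₁ c₂ c₃  : Code
        index-eq     : ⌜ c₀ ⌝ ⊗ ⌜ c₁ ⌝ ⊗ ⌜ c₂ ⌝ ⊗ ⌜ c₃ ⌝ ≡ e
        decides-dom  : Decides ∅ c₀ Dom
        enumerates-R : Enumerates ∅ c₁ PositiveDiagram
        enumerates-¬R : Enumerates ∅ c₂ NegativeDiagram
        enumerates-F : Enumerates ∅ c₃ FunctionGraph

  record IsAge (K : Pred (Structure L) (lsuc 0ℓ)) : Set₁ where
    field
      finitelyGenerated : ∀ {A} → K A → FinitelyGenerated A
      iso-closed        : ∀ {A B} → A ≅ B → K A → K B

  IsAmalgamationBase : Pred (Structure L) (lsuc 0ℓ) → Structure L → Set₁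
  IsAmalgamationBase K A = K A ×
    (∀ {B C} → K B → K C → (f : Embedding A B) (g : Embedding A C) →
     ∃[ D ] (K D × Σ[ α ∈ Embedding B D ] Σ[ β ∈ Embedding C D ]
       (∀ x → to α (to f x) ≡ to β (to g x))))

  HasCAP : Pred (Structure L) (lsuc 0ℓ) → Set₁
  HasCAP K = ∀ {A} → K A → ∃[ B ] (IsAmalgamationBase K B × Embedding A B)

-- 𝕂 = { 𝕀 i ∣ i ∈ ω }, so there is exactly one triple for each i.
record ComputableAge (L : Language) : Set₂ where
  field
    K     : Pred (Structure L) (lsuc 0ℓ)
    isAge : IsAge K

    𝒜     : ℕ → ωStructure L
    index : ℕ → ℕ
    rank  : ℕ → ℕ
    gens  : ∀ i → Vec (ωStructure.Element (𝒜 i)) (rank i)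

  𝓢 : ℕ → Structure L
  𝓢 i = ωStructure.structure (𝒜 i)

  𝕀 : ℕ → ℕ
  𝕀 i = tupleᴹ (𝒜 i) (gens i) ⊗ index i ⊗ i

  field
    index-correct : ∀ i → IsIndex (𝒜 i) (index i)
    𝕂-ce          : CE (λ n → ∃[ i ] 𝕀 i ≡ n)
    𝓢∈K           : ∀ i → K (𝓢 i)
    generated     : ∀ i → GeneratedBy (𝓢 i) (gens i)
    exhaustive    : ∀ {B} → K B → ∃[ i ] B ≅ 𝓢 i

module _ {L : Language} (𝕂 : ComputableAge L) where
  open ComputableAge 𝕂
  open Embedding

  private
    Elem : ℕ → Set
    Elem i = ωStructure.Element (𝒜 i)

  EI : Pred ℕ 0ℓ
  EI n = ∃[ k₀ ] ∃[ k₁ ] ∃[ m ] Σ[ b₀ ∈ Vec (Elem k₀) m ] Σ[ b₁ ∈ Vec (Elem k₁) m ]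
    (SameAtomicType (𝓢 k₀) (𝓢 k₁) b₀ b₁ ×
     𝕀 k₀ ⊗ tupleᴹ (𝒜 k₀) b₀ ⊗ 𝕀 k₁ ⊗ tupleᴹ (𝒜 k₁) b₁ ≡ n)

  -- PotEmb i j are the potential embeddings with domain 𝕀 i and codomain 𝕀 j.
  -- The length of the range is not constrained.
  record PotEmb (i j : ℕ) : Set where
    constructor potEmb
    field
      len   : ℕ
      range : Vec (Elem j) len

  ⌜_⌝ᴱ : ∀ {i j} → PotEmb i j → ℕ
  ⌜_⌝ᴱ {i} {j} F = 𝕀 i ⊗ 𝕀 j ⊗ tupleᴹ (𝒜 j) (PotEmb.range F)

  -- Atomic types are compared only between tuples of the same length.
  data IsEmb {i j : ℕ} : PotEmb i j → Set where
    isEmb : {c : Vec (Elem j) (rank i)} → SameAtomicType (𝓢 i) (𝓢 j) (gens i) c →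
            IsEmb (potEmb (rank i) c)

  Emb : ℕ → ℕ → Set
  Emb i j = Σ[ F ∈ PotEmb i j ] IsEmb F

  encoded : ∀ {i j} {F : PotEmb i j} → IsEmb F → Embedding (𝓢 i) (𝓢 j)
  encoded {i} (isEmb a≃c) = extend (generated i) a≃c

  infixr 9 _∘ᴱ_
  _∘ᴱ_ : ∀ {i j k} → Emb j k → Emb i j → Emb i k
  _∘ᴱ_ {i} {j} {k} (_ , g) (_ , isEmb {c} a≃c) =
    potEmb (rank i) (map (to (encoded g)) c) , isEmb (λ φ → mk⇔
      (λ p → Equivalence.to (c≃gc φ) (Equivalence.to (a≃c φ) p))
      (λ p → Equivalence.from (a≃c φ) (Equivalence.from (c≃gc φ) p)))
    where
    c≃gc : SameAtomicType (𝓢 j) (𝓢 k) c (map (to (encoded g)) c)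
    c≃gc = embedding-preserves-type (encoded g) c

  record IsAmalgamationDiagram {i j₀ j₁ k} (F₀ : PotEmb i j₀) (F₁ : PotEmb i j₁)
                               (G₀ : PotEmb j₀ k) (G₁ : PotEmb j₁ k) : Set where
    field
      G₀-emb : IsEmb G₀
      amalgamates : (f₀ : IsEmb F₀) (f₁ : IsEmb F₁) → Σ[ g₁ ∈ IsEmb G₁ ]
        (∀ x → to (encoded G₀-emb) (to (encoded f₀) x) ≡ to (encoded g₁) (to (encoded f₁) x))

  Collection : Set₂
  Collection = ∀ {i j} → PotEmb i j → Set₁

  codes : Collection → Pred ℕ (lsuc 0ℓ)
  codes X n = ∃[ i ] ∃[ j ] Σ[ F ∈ PotEmb i j ] (X F × ⌜ F ⌝ᴱ ≡ n)

  record IsDistinguished (X : Collection) : Set₁ where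
    field
      embeddings  : ∀ {i j} {F : PotEmb i j} → X F → IsEmb F
      pre-closed  : ∀ {h i j} {F : PotEmb i j} → X F → (f : IsEmb F) (σ : Emb h i) →
                    IsIsomorphism (encoded (proj₂ σ)) → X (proj₁ ((F , f) ∘ᴱ σ))
      post-closed : ∀ {i j k} {F : PotEmb i j} → X F → (f : IsEmb F) (σ : Emb j k) →
                    IsIsomorphism (encoded (proj₂ σ)) → X (proj₁ (σ ∘ᴱ (F , f)))
      total       : ∀ i → ∃[ j ] Σ[ F ∈ PotEmb i j ] X F

  record CAPWitness : Set₂ where
    field
      AB₀           : Collection
      distinguished : IsDistinguished AB₀
      bases         : ∀ {i j} {F : PotEmb i j} → AB₀ F → IsAmalgamationBase K (𝓢 j)
      f             : PartialFunction
      amalgamates   : ∀ {i j k₀ k₁} {F : PotEmb i j} → AB₀ F →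
        (G₀ : PotEmb j k₀) (G₁ : PotEmb j k₁) →
        ∃[ l ] Σ[ H₀ ∈ PotEmb k₀ l ] Σ[ H₁ ∈ PotEmb k₁ l ]
          (IsAmalgamationDiagram G₀ G₁ H₀ H₁ ×
           PartialFunction.graph f (⌜ F ⌝ᴱ ⊗ ⌜ G₀ ⌝ᴱ ⊗ ⌜ G₁ ⌝ᴱ) (⌜ H₀ ⌝ᴱ ⊗ ⌜ H₁ ⌝ᴱ))

  _-cCAP : Pred ℕ 0ℓ → Set₂
  S -cCAP = Σ[ W ∈ CAPWitness ]
    (CE-in S (codes (CAPWitness.AB₀ W)) × PartialComputable-in S (CAPWitness.f W))

  AB : Collection
  AB {j = j} F = IsEmb F × IsAmalgamationBase K (𝓢 j)

{-# OPTIONS --safe #-}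

-- 𝓢 j is an amalgamation base iff every span over it in 𝕂 is amalgamated inside 𝕂.  Equality of
-- the two composites can be expressed by ≃: a span from 𝓢 j to 𝓢 k₀, 𝓢 k₁ with ranges c₀, c₁ is
-- amalgamated in 𝓢 l iff there are e, d₀, d₁ in 𝓢 l with gens j ≃ e and cₙ ⌢ gens kₙ ≃ e ⌢ dₙ for
-- n = 0, 1.  So being a span is decidable in EI and being amalgamated is Σ₁ in EI, hence being a
-- base is Π₂ in EI and decidable in EI″.  No separate check that numbers code tuples or members of
-- 𝕂 is needed, because EI only contains valid codes.  For (b), AB itself serves as AB₀: (CAP) makes
-- it total, a diagram over a span out of a base is found by unbounded search with oracle EI, and
-- over a pair that is not a span the identity and an empty range will do.

module Submission where

open import Level using (0ℓ; lift; lower) renaming (suc to lsuc)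
open import Axiom.ExcludedMiddle using (ExcludedMiddle)
open import Data.Fin.Base using (_↑ʳ_)
open import Data.List.Base as List using (List; []; _∷_)
open import Data.List.Properties using (ʳ++-ʳ++)
open import Data.Nat.Base using (ℕ; zero; suc; _+_; _≤_; _<_; _⊔_; z≤n; s≤s)
open import Data.Nat.Properties
  using (≤-refl; ≤-trans; m≤n+m; m≤m⊔n; m≤n⊔m; <-cmp; m<1+n⇒m<n∨m≡n; suc-injective; 1+n≢0)
open import Data.Product.Base
  using (∃; ∃-syntax; Σ-syntax; _×_; _,_; proj₁; proj₂; uncurry; map₂)
open import Data.Refinement.Base as Refinement using (value)
open import Data.Sum.Base using (_⊎_; inj₁; inj₂)
open import Data.Vec.Base as Vec using (Vec; []; _∷_; _++_; map)
open import Data.Vec.Properties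
  using (toList-++; map-++; map-∘; map-cong; ++-injective; lookup-++ʳ)
open import Data.Vec.Relation.Unary.All using (All; []; _∷_)
open import Function.Base using (_∘_; id)
open import Function.Bundles using (_⇔_; mk⇔; Equivalence)
open import Relation.Binary.Definitions using (tri<; tri≈; tri>)
open import Relation.Binary.PropositionalEquality
open import Relation.Nullary.Decidable.Core using (Dec; yes; no; map′; decidable-stable)
open import Relation.Nullary.Negation.Core using (¬_; contradiction)
open import Relation.Unary using (Pred)
open import Defs

-- Inverting the Cantor pairing function

π₁ π₂ : ℕ → ℕ
π₁ = proj₁ ∘ unpair
π₂ = proj₂ ∘ unpair

π₁-⊗ : ∀ a b → π₁ (a ⊗ b) ≡ a
π₁-⊗ a b = cong proj₁ (unpair-⊗ a b)

π₂-⊗ : ∀ a b → π₂ (a ⊗ b) ≡ b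
π₂-⊗ a b = cong proj₂ (unpair-⊗ a b)

⊗-injective : ∀ {a b c d} → a ⊗ b ≡ c ⊗ d → a ≡ c × b ≡ d
⊗-injective {a} {b} {c} {d} e =
  trans (sym (π₁-⊗ a b)) (trans (cong π₁ e) (π₁-⊗ c d)) ,
  trans (sym (π₂-⊗ a b)) (trans (cong π₂ e) (π₂-⊗ c d))

next-⊗ : ∀ p → uncurry _⊗_ (next p) ≡ suc (uncurry _⊗_ p)
next-⊗ (zero  , b) = ⊗-row b
next-⊗ (suc a , b) = ⊗-diagonal a b

⊗-unpair : ∀ n → π₁ n ⊗ π₂ n ≡ n
⊗-unpair zero    = refl
⊗-unpair (suc n) = trans (next-⊗ (unpair n)) (cong suc (⊗-unpair n))

-- Codes of programs

height : Code → ℕ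
height (pairᶜ c d) = suc (height c ⊔ height d)
height (compᶜ c d) = suc (height c ⊔ height d)
height (precᶜ c d) = suc (height c ⊔ height d)
height (μᶜ c)      = suc (height c)
height _           = 1

-- A left inverse of `⌜_⌝` that recurses on fuel, since the components of a number are not
-- structurally smaller than it. Tag 0, unknown tags and exhausted fuel all give `zeroᶜ`.
decode     : ℕ → ℕ → Code
decodeNode : ℕ → ℕ × ℕ → Code
decode zero    n = zeroᶜ
decode (suc k) n = decodeNode k (unpair n)
decodeNode k (1 , _) = sucᶜ
decodeNode k (2 , _) = fstᶜ
decodeNode k (3 , _) = sndᶜ
decodeNode k (4 , _) = oracleᶜ
decodeNode k (5 , n) = pairᶜ (decode k (π₁ n)) (decode k (π₂ n))
decodeNode k (6 , n) = compᶜ (decode k (π₁ n)) (decode k (π₂ n))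
decodeNode k (7 , n) = precᶜ (decode k (π₁ n)) (decode k (π₂ n))
decodeNode k (8 , n) = μᶜ (decode k n)
decodeNode k _       = zeroᶜ

decode-⌜⌝ : ∀ c {k} → height c ≤ k → decode k ⌜ c ⌝ ≡ c
decode-pair : ∀ c d {k} → height c ⊔ height d ≤ k → (f : Code → Code → Code) →
              f (decode k (π₁ (⌜ c ⌝ ⊗ ⌜ d ⌝))) (decode k (π₂ (⌜ c ⌝ ⊗ ⌜ d ⌝))) ≡ f c d
decode-⌜⌝ zeroᶜ   (s≤s h) = refl
decode-⌜⌝ sucᶜ    (s≤s h) = refl
decode-⌜⌝ fstᶜ    (s≤s h) = refl
decode-⌜⌝ sndᶜ    (s≤s h) = refl
decode-⌜⌝ oracleᶜ (s≤s h) = refl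
decode-⌜⌝ (pairᶜ c d) (s≤s h) =
  trans (cong (decodeNode _) (unpair-⊗ 5 (⌜ c ⌝ ⊗ ⌜ d ⌝))) (decode-pair c d h pairᶜ)
decode-⌜⌝ (compᶜ c d) (s≤s h) =
  trans (cong (decodeNode _) (unpair-⊗ 6 (⌜ c ⌝ ⊗ ⌜ d ⌝))) (decode-pair c d h compᶜ)
decode-⌜⌝ (precᶜ c d) (s≤s h) =
  trans (cong (decodeNode _) (unpair-⊗ 7 (⌜ c ⌝ ⊗ ⌜ d ⌝))) (decode-pair c d h precᶜ)
decode-⌜⌝ (μᶜ c)  (s≤s h) =
  trans (cong (decodeNode _) (unpair-⊗ 8 ⌜ c ⌝)) (cong μᶜ (decode-⌜⌝ c h))
decode-pair c d {k} h f = cong₂ f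
  (trans (cong (decode k) (π₁-⊗ ⌜ c ⌝ ⌜ d ⌝)) (decode-⌜⌝ c (≤-trans (m≤m⊔n _ _) h)))
  (trans (cong (decode k) (π₂-⊗ ⌜ c ⌝ ⌜ d ⌝)) (decode-⌜⌝ d (≤-trans (m≤n⊔m _ _) h)))

-- Both codes are decoded with the larger height as fuel. Hence an index in the jump determines its
-- program.
⌜⌝-injective : ∀ {c d} → ⌜ c ⌝ ≡ ⌜ d ⌝ → c ≡ d
⌜⌝-injective {c} {d} e =
  trans (sym (decode-⌜⌝ c (m≤m⊔n (height c) (height d))))
    (trans (cong (decode (height c ⊔ height d)) e)
      (decode-⌜⌝ d (m≤n⊔m (height c) (height d))))

-- Determinism and relativisation

module _ {O : Pred ℕ 0ℓ} where

  -- The recursion descends on the program, except in the step case of `precᶜ`, where the program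
  -- stays and the derivation shrinks.
  deterministic : ∀ c {n u v} → O ⊢ c · n ↓ u → O ⊢ c · n ↓ v → u ≡ v
  deterministic _ zero↓    zero↓     = refl
  deterministic _ suc↓     suc↓      = refl
  deterministic _ fst↓     fst↓      = refl
  deterministic _ snd↓     snd↓      = refl
  deterministic _ (yes↓ _) (yes↓ _)  = refl
  deterministic _ (yes↓ o) (no↓ ¬o)  = contradiction o ¬o
  deterministic _ (no↓ ¬o) (yes↓ o)  = contradiction o ¬o
  deterministic _ (no↓ _)  (no↓ _)   = refl
  deterministic (pairᶜ c d) (pair↓ p q) (pair↓ p′ q′) =
    cong₂ _⊗_ (deterministic c p p′) (deterministic d q q′)
  deterministic (compᶜ c d) (comp↓ p q) (comp↓ p′ q′)
    with refl ← deterministic d p p′ = deterministic c q q′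
  deterministic (precᶜ c d) (prec₀↓ e p) (prec₀↓ e′ p′)
    with refl ← trans (sym e) e′ = deterministic c p p′
  deterministic (precᶜ c d) (prec₀↓ e p) (prec₊↓ e′ p′ q′) with () ← trans (sym e) e′
  deterministic (precᶜ c d) (prec₊↓ e p q) (prec₀↓ e′ p′) with () ← trans (sym e) e′
  deterministic (precᶜ c d) (prec₊↓ e p q) (prec₊↓ e′ p′ q′)
    with refl ← trans (sym e) e′
    with refl ← deterministic (precᶜ c d) p p′ = deterministic d q q′
  -- If the results differ, the smaller one is a zero of `c` at which the other search saw a
  -- successor.
  deterministic (μᶜ c) (μ↓ {k = k} p f) (μ↓ {k = k′} p′ f′) with <-cmp k k′
  ... | tri< k<k′ _ _ = contradiction (deterministic c (proj₂ (f′ k k<k′)) p) 1+n≢0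
  ... | tri≈ _ k≡k′ _ = k≡k′
  ... | tri> _ _ k′<k = contradiction (deterministic c (proj₂ (f k′ k′<k)) p′) 1+n≢0

withOracle : Code → Code → Code
withOracle o oracleᶜ     = o
withOracle o (pairᶜ c d) = pairᶜ (withOracle o c) (withOracle o d)
withOracle o (compᶜ c d) = compᶜ (withOracle o c) (withOracle o d)
withOracle o (precᶜ c d) = precᶜ (withOracle o c) (withOracle o d)
withOracle o (μᶜ c)      = μᶜ (withOracle o c)
withOracle o c           = c

module _ {A B : Pred ℕ 0ℓ} {o : Code} (decides : Decides B o A) where

  -- Oracle answers are replaced by runs of `o`, and the rest of the derivation is copied. This
  -- gives transitivity of `_≤T_` and later moves the diagram program to a stronger oracle.
  withOracle-↓ : ∀ c {n v} → A ⊢ c · n ↓ v → B ⊢ withOracle o c · n ↓ v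
  withOracle-↓ _ zero↓    = zero↓
  withOracle-↓ _ suc↓     = suc↓
  withOracle-↓ _ fst↓     = fst↓
  withOracle-↓ _ snd↓     = snd↓
  withOracle-↓ _ (yes↓ a) = proj₁ (decides _) a
  withOracle-↓ _ (no↓ ¬a) = proj₂ (decides _) ¬a
  withOracle-↓ (pairᶜ c d) (pair↓ p q)    = pair↓ (withOracle-↓ c p) (withOracle-↓ d q)
  withOracle-↓ (compᶜ c d) (comp↓ p q)    = comp↓ (withOracle-↓ d p) (withOracle-↓ c q)
  withOracle-↓ (precᶜ c d) (prec₀↓ e p)   = prec₀↓ e (withOracle-↓ c p)
  withOracle-↓ (precᶜ c d) (prec₊↓ e p q) =
    prec₊↓ e (withOracle-↓ (precᶜ c d) p) (withOracle-↓ d q)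
  withOracle-↓ (μᶜ c) (μ↓ p f)            =
    μ↓ (withOracle-↓ c p) (λ j j<k → map₂ (withOracle-↓ c) (f j j<k))

-- Total computable functions

record Recursive (O : Pred ℕ 0ℓ) (f : ℕ → ℕ) : Set where
  constructor recursive
  field
    program : Code
    halts   : ∀ n → O ⊢ program · n ↓ f n

open Recursive

-- The function that `precᶜ` computes, with the argument of the step packed as in `prec₊↓`.
primrec : (ℕ → ℕ) → (ℕ → ℕ) → ℕ → ℕ → ℕ
primrec f g a zero    = f a
primrec f g a (suc k) = g (a ⊗ k ⊗ primrec f g a k)

constᶜ : ℕ → Code
constᶜ zero    = zeroᶜ
constᶜ (suc k) = compᶜ sucᶜ (constᶜ k)

module _ {O : Pred ℕ 0ℓ} where

  private variable f g : ℕ → ℕ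

  sucʳ : Recursive O suc
  sucʳ = recursive sucᶜ λ _ → suc↓

  fstʳ : Recursive O π₁
  fstʳ = recursive fstᶜ λ _ → fst↓

  sndʳ : Recursive O π₂
  sndʳ = recursive sndᶜ λ _ → snd↓

  infixr 6 _⊗ʳ_
  _⊗ʳ_ : Recursive O f → Recursive O g → Recursive O (λ n → f n ⊗ g n)
  F ⊗ʳ G = recursive (pairᶜ (program F) (program G)) λ n → pair↓ (halts F n) (halts G n)

  infixr 9 _∘ʳ_
  _∘ʳ_ : Recursive O f → Recursive O g → Recursive O (f ∘ g)
  F ∘ʳ G = recursive (compᶜ (program F) (program G)) λ n → comp↓ (halts G n) (halts F _)

  constᶜ-↓ : ∀ k {n} → O ⊢ constᶜ k · n ↓ k
  constᶜ-↓ zero    = zero↓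
  constᶜ-↓ (suc k) = comp↓ (constᶜ-↓ k) suc↓

  constʳ : ∀ k → Recursive O (λ _ → k)
  constʳ k = recursive (constᶜ k) λ _ → constᶜ-↓ k

  castʳ : f ≗ g → Recursive O f → Recursive O g
  castʳ f≗g F = recursive (program F) λ n → subst (O ⊢ program F · n ↓_) (f≗g n) (halts F n)

  idʳ : Recursive O id
  -- `Code` has no identity program, so the input is taken apart and paired again.
  idʳ = castʳ ⊗-unpair (fstʳ ⊗ʳ sndʳ)

  primrecʳ : ∀ {a k} → Recursive O f → Recursive O g → Recursive O a → Recursive O k →
             Recursive O (λ n → primrec f g (a n) (k n))
  primrecʳ {f} {g} {a} {k} F G A K =
    recursive (compᶜ (precᶜ (program F) (program G)) (program (A ⊗ʳ K)))
      λ n → comp↓ (halts (A ⊗ʳ K) n) (go (k n) (unpair-⊗ (a n) (k n)))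
    where
    go : ∀ k {a n} → unpair n ≡ (a , k) →
         O ⊢ precᶜ (program F) (program G) · n ↓ primrec f g a k
    go zero    e = prec₀↓ e (halts F _)
    go (suc k) e = prec₊↓ e (go k (unpair-⊗ _ k)) (halts G _)

-- Concatenation of tuples

-- The coding of `tuple` on lists, where reversal needs no bookkeeping of lengths.
listCode : List ℕ → ℕ
listCode []       = 0
listCode (x ∷ xs) = suc (x ⊗ listCode xs)

tuple-listCode : ∀ {n} (xs : Vec ℕ n) → tuple xs ≡ listCode (Vec.toList xs)
tuple-listCode []       = refl
tuple-listCode (x ∷ xs) = cong (λ t → suc (x ⊗ t)) (tuple-listCode xs)

-- This lets the code of a list serve as the number of iterations when reversing it.
length≤listCode : ∀ xs → List.length xs ≤ listCode xs
length≤listCode []       = z≤n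
length≤listCode (x ∷ xs) =
  s≤s (≤-trans (length≤listCode xs) (m≤n+m (listCode xs) (triangle (x + listCode xs))))

-- One step of list reversal, on states (accumulator ⊗ remaining list).
pushStep : ℕ → ℕ
pushStep n = suc (π₁ (π₁ (π₂ n)) ⊗ π₁ n) ⊗ π₂ (π₁ (π₂ n))

-- Recursion serves as case distinction here: code 0 is the empty list, and a positive code is a
-- head paired with a tail.
push : ℕ → ℕ
push n = primrec (_⊗ 0) pushStep (π₁ n) (π₂ n)

pushes : ℕ → ℕ → ℕ
pushes = primrec id (λ n → push (π₂ (π₂ n)))

reverseOnto : ℕ → ℕ
reverseOnto n = π₁ (pushes n (π₂ n))

-- Two reversals, the second one onto `b`, so that iterating `push` suffices.
append : ℕ → ℕ → ℕ
append a b = reverseOnto (b ⊗ reverseOnto (0 ⊗ a))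

push-[] : ∀ ys → push (ys ⊗ 0) ≡ ys ⊗ 0
push-[] ys rewrite unpair-⊗ ys 0 = refl

push-∷ : ∀ ys x xs → push (ys ⊗ suc (x ⊗ xs)) ≡ suc (x ⊗ ys) ⊗ xs
push-∷ ys x xs
  rewrite unpair-⊗ ys (suc (x ⊗ xs))
        | unpair-⊗ ys ((x ⊗ xs) ⊗ primrec (_⊗ 0) pushStep ys (x ⊗ xs))
        | unpair-⊗ (x ⊗ xs) (primrec (_⊗ 0) pushStep ys (x ⊗ xs))
        | unpair-⊗ x xs = refl

pushes-suc : ∀ s k → pushes s (suc k) ≡ push (pushes s k)
pushes-suc s k rewrite unpair-⊗ s (k ⊗ pushes s k) | unpair-⊗ k (pushes s k) = refl

-- Moves the last iteration to the front, where an induction on the remaining list consumes it.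
pushes-push : ∀ s k → pushes s (suc k) ≡ pushes (push s) k
pushes-push s zero    = pushes-suc s zero
pushes-push s (suc k) =
  trans (pushes-suc s (suc k)) (trans (cong push (pushes-push s k)) (sym (pushes-suc (push s) k)))

-- Surplus iterations do no harm, because a state with empty remaining list is fixed by `push`.
pushes-reverse : ∀ xs ys k → List.length xs ≤ k →
  pushes (listCode ys ⊗ listCode xs) k ≡ listCode (xs List.ʳ++ ys) ⊗ 0
pushes-reverse []       ys zero    _       = refl
pushes-reverse []       ys (suc k) _       =
  trans (pushes-push (listCode ys ⊗ 0) k)
    (trans (cong (λ s → pushes s k) (push-[] (listCode ys))) (pushes-reverse [] ys k z≤n))
pushes-reverse (x ∷ xs) ys (suc k) (s≤s h) =
  trans (pushes-push (listCode ys ⊗ listCode (x ∷ xs)) k)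
    (trans (cong (λ s → pushes s k) (push-∷ (listCode ys) x (listCode xs)))
      (pushes-reverse xs (x ∷ ys) k h))

reverseOnto-listCode : ∀ xs ys →
  reverseOnto (listCode ys ⊗ listCode xs) ≡ listCode (xs List.ʳ++ ys)
reverseOnto-listCode xs ys = trans
  (cong π₁ (trans (cong (pushes (listCode ys ⊗ listCode xs)) (π₂-⊗ (listCode ys) (listCode xs)))
                  (pushes-reverse xs ys (listCode xs) (length≤listCode xs))))
  (π₁-⊗ _ 0)

append-listCode : ∀ xs ys → append (listCode xs) (listCode ys) ≡ listCode (xs List.++ ys)
append-listCode xs ys = trans
  (cong (λ t → reverseOnto (listCode ys ⊗ t)) (reverseOnto-listCode xs []))
  (trans (reverseOnto-listCode (xs List.ʳ++ []) ys) (cong listCode (ʳ++-ʳ++ xs)))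

append-tuple : ∀ {m n} (xs : Vec ℕ m) (ys : Vec ℕ n) →
  append (tuple xs) (tuple ys) ≡ tuple (xs Vec.++ ys)
append-tuple xs ys = trans (cong₂ append (tuple-listCode xs) (tuple-listCode ys))
  (trans (append-listCode (Vec.toList xs) (Vec.toList ys))
    (trans (cong listCode (sym (toList-++ xs ys))) (sym (tuple-listCode (xs Vec.++ ys)))))

module _ {O : Pred ℕ 0ℓ} where

  reverseOntoʳ : Recursive O reverseOnto
  reverseOntoʳ = fstʳ ∘ʳ primrecʳ idʳ (pushʳ ∘ʳ sndʳ ∘ʳ sndʳ) idʳ sndʳ
    where
    pushʳ : Recursive O push
    pushʳ = primrecʳ (idʳ ⊗ʳ constʳ 0)
      (sucʳ ∘ʳ (fstʳ ∘ʳ fstʳ ∘ʳ sndʳ ⊗ʳ fstʳ) ⊗ʳ sndʳ ∘ʳ fstʳ ∘ʳ sndʳ) fstʳ sndʳ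

  appendʳ : ∀ {f g} → Recursive O f → Recursive O g → Recursive O (λ n → append (f n) (g n))
  appendʳ F G = reverseOntoʳ ∘ʳ (G ⊗ʳ reverseOntoʳ ∘ʳ (constʳ 0 ⊗ʳ F))

-- Decidable and enumerable sets

module _ {O : Pred ℕ 0ℓ} where

  query : ∀ {f} → Recursive O f → (O ∘ f) ≤T O
  query F = compᶜ oracleᶜ (program F) , λ n →
    (λ o → comp↓ (halts F n) (yes↓ o)) , (λ ¬o → comp↓ (halts F n) (no↓ ¬o))

  ≤T-cast : ∀ {a b} {A : Pred ℕ a} {B : Pred ℕ b} → (∀ n → A n ⇔ B n) → A ≤T O → B ≤T O
  ≤T-cast A⇔B (c , d) = c , λ n →
    proj₁ (d n) ∘ Equivalence.from (A⇔B n) ,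
    λ ¬b → proj₂ (d n) (¬b ∘ Equivalence.to (A⇔B n))

  CE-cast : ∀ {a b} {A : Pred ℕ a} {B : Pred ℕ b} → (∀ n → A n ⇔ B n) → CE-in O A → CE-in O B
  CE-cast A⇔B (c , e) = c , λ n → mk⇔
    (Equivalence.to (e n) ∘ Equivalence.from (A⇔B n))
    (Equivalence.to (A⇔B n) ∘ Equivalence.from (e n))

  infixr 9 _∘ᵈ_
  _∘ᵈ_ : ∀ {a} {A : Pred ℕ a} {f} → A ≤T O → Recursive O f → (A ∘ f) ≤T O
  _∘ᵈ_ {f = f} (c , d) F = compᶜ c (program F) , λ n →
    comp↓ (halts F n) ∘ proj₁ (d (f n)) , comp↓ (halts F n) ∘ proj₂ (d (f n))

≤T-trans : ∀ {a} {A : Pred ℕ a} {B C : Pred ℕ 0ℓ} → A ≤T B → B ≤T C → A ≤T C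
≤T-trans (c , d) (o , e) = withOracle o c , λ n →
  withOracle-↓ {o = o} e c ∘ proj₁ (d n) , withOracle-↓ {o = o} e c ∘ proj₂ (d n)

-- Hard-wired inputs, the halting problem and branching

constᶜ-code : ℕ → ℕ
-- 6 is the tag of `compᶜ`, and `π₂ (π₂ m)` is the code from the previous stage.
constᶜ-code = primrec (λ _ → 0) (λ m → 6 ⊗ ⌜ sucᶜ ⌝ ⊗ π₂ (π₂ m)) 0

constᶜ-code-correct : ∀ k → constᶜ-code k ≡ ⌜ constᶜ k ⌝
constᶜ-code-correct zero    = refl
constᶜ-code-correct (suc k) = cong (λ t → 6 ⊗ ⌜ sucᶜ ⌝ ⊗ t) (begin
  π₂ (π₂ (0 ⊗ k ⊗ constᶜ-code k)) ≡⟨ cong π₂ (π₂-⊗ 0 (k ⊗ constᶜ-code k)) ⟩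
  π₂ (k ⊗ constᶜ-code k)          ≡⟨ π₂-⊗ k (constᶜ-code k) ⟩
  constᶜ-code k                   ≡⟨ constᶜ-code-correct k ⟩
  ⌜ constᶜ k ⌝                    ∎)
  where open ≡-Reasoning

specialise : Code → ℕ → Code
specialise c n = compᶜ c (constᶜ n)

specialiseʳ : ∀ {O} c → Recursive O (λ n → ⌜ specialise c n ⌝)
specialiseʳ c = castʳ (λ n → cong (λ t → 6 ⊗ ⌜ c ⌝ ⊗ t) (constᶜ-code-correct n))
  (constʳ 6 ⊗ʳ constʳ ⌜ c ⌝ ⊗ʳ
    primrecʳ (constʳ 0) (constʳ 6 ⊗ʳ constʳ ⌜ sucᶜ ⌝ ⊗ʳ sndʳ ∘ʳ sndʳ) (constʳ 0) idʳ)

-- The jump asks about self-application. As `specialise c n` ignores its own input, it halts on its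
-- own code iff `c` halts on `n`, and its code is computable from `n`.
halting≤T′ : ∀ {O} c → (λ n → ∃[ v ] O ⊢ c · n ↓ v) ≤T O ′
halting≤T′ {O} c =
  ≤T-cast (λ n → mk⇔ (to n) (from n)) (query {f = ⌜_⌝ ∘ specialise c} (specialiseʳ c))
  where
  to : ∀ n → (O ′) ⌜ specialise c n ⌝ → ∃[ v ] O ⊢ c · n ↓ v
  to n (c′ , e , v , p) with refl ← ⌜⌝-injective {c′} {specialise c n} e
    with comp↓ q r ← p with refl ← deterministic (constᶜ n) q (constᶜ-↓ n) = v , r

  from : ∀ n → (∃[ v ] O ⊢ c · n ↓ v) → (O ′) ⌜ specialise c n ⌝
  from n (v , p) = specialise c n , refl , v , comp↓ (constᶜ-↓ n) p

-- If-then-else on `(a ⊗ b) ⊗ bit`: bit 1 selects `a`, bit 0 selects `b`. Both alternatives are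
-- evaluated beforehand, so `branch` takes total ones.
condition : ℕ → ℕ
condition n = primrec π₂ (λ m → π₁ (π₁ m)) (π₁ n) (π₂ n)

condition-0 : ∀ a b → condition ((a ⊗ b) ⊗ 0) ≡ b
condition-0 a b rewrite unpair-⊗ (a ⊗ b) 0 = π₂-⊗ a b

condition-1 : ∀ a b → condition ((a ⊗ b) ⊗ 1) ≡ a
condition-1 a b rewrite unpair-⊗ (a ⊗ b) 1 =
  trans (cong π₁ (π₁-⊗ (a ⊗ b) (0 ⊗ π₂ (a ⊗ b)))) (π₁-⊗ a b)

module _ {O : Pred ℕ 0ℓ} where

  branch : ∀ {A : Pred ℕ 0ℓ} {f g} → A ≤T O → Recursive O f → Recursive O g →
           ∃[ c ] ∀ n → (A n → O ⊢ c · n ↓ f n) × (¬ A n → O ⊢ c · n ↓ g n)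
  branch {A} {f} {g} (d , decides) F G =
    compᶜ (program conditionʳ) (pairᶜ (program (F ⊗ʳ G)) d) , λ n →
      (λ a → subst (O ⊢ _ · n ↓_) (condition-1 (f n) (g n))
        (comp↓ (pair↓ (halts (F ⊗ʳ G) n) (proj₁ (decides n) a)) (halts conditionʳ _))) ,
      (λ ¬a → subst (O ⊢ _ · n ↓_) (condition-0 (f n) (g n))
        (comp↓ (pair↓ (halts (F ⊗ʳ G) n) (proj₂ (decides n) ¬a)) (halts conditionʳ _)))
    where
    conditionʳ : Recursive O condition
    conditionʳ = primrecʳ sndʳ (fstʳ ∘ʳ fstʳ) fstʳ sndʳ

-- Boolean operations and unbounded search under excluded middle

module Classical (em : ExcludedMiddle 0ℓ) where

  stable : {P : Set} → ¬ ¬ P → P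
  stable = decidable-stable em

  -- `μ↓` requires every earlier value to be a successor, so a search halts at the least witness.
  least : {P : ℕ → Set} → ∃ P → ∃[ k ] (P k × ∀ j → j < k → ¬ P j)
  least {P} (k , p) with below (suc k)
    where
    below : ∀ k → (∃[ k ] (P k × ∀ j → j < k → ¬ P j)) ⊎ (∀ j → j < k → ¬ P j)
    below zero    = inj₂ λ _ ()
    below (suc k) with below k | em {P k}
    ... | inj₁ found | _     = inj₁ found
    ... | inj₂ none  | yes p = inj₁ (k , p , none)
    ... | inj₂ none  | no ¬p = inj₂ extended
      where
      extended : ∀ j → j < suc k → ¬ P j
      extended j j<1+k p with m<1+n⇒m<n∨m≡n j<1+k
      ... | inj₁ j<k  = none j j<k p
      ... | inj₂ refl = ¬p p
  ... | inj₁ found = found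
  ... | inj₂ none  = contradiction p (none k ≤-refl)

  module _ {O : Pred ℕ 0ℓ} where

    ¬ᵈ_ : {A : Pred ℕ 0ℓ} → A ≤T O → (λ n → ¬ A n) ≤T O
    ¬ᵈ_ (c , d) = compᶜ (program notʳ) c , λ n →
      (λ ¬a → comp↓ (proj₂ (d n) ¬a) (halts notʳ 0)) ,
      -- `Decides` gives output 1 only from a proof of `A n`, so the double negation is removed
      -- classically.
      (λ ¬¬a → comp↓ (proj₁ (d n) (stable ¬¬a)) (halts notʳ 1))
      where
      notʳ : Recursive O (primrec (λ _ → 1) (λ _ → 0) 0)
      notʳ = primrecʳ (constʳ 1) (constʳ 0) (constʳ 0) idʳ

    infixr 2 _×ᵈ_
    _×ᵈ_ : {A B : Pred ℕ 0ℓ} → A ≤T O → B ≤T O → (λ n → A n × B n) ≤T O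
    _×ᵈ_ {A} {B} (c , d) (c′ , d′) = compᶜ (program andʳ) (pairᶜ c c′) , λ n →
      (λ (a , b) → comp↓ (pair↓ (proj₁ (d n) a) (proj₁ (d′ n) b)) (halts andʳ (1 ⊗ 1))) ,
      no-case n
      where
      andʳ : Recursive O (λ n → primrec (λ _ → 0) π₁ (π₁ n) (π₂ n))
      andʳ = primrecʳ (constʳ 0) fstʳ fstʳ sndʳ

      no-case : ∀ n → ¬ (A n × B n) → O ⊢ compᶜ (program andʳ) (pairᶜ c c′) · n ↓ 0
      no-case n ¬ab with em {A n} | em {B n}
      ... | yes a | yes b = contradiction (a , b) ¬ab
      ... | yes a | no ¬b =
        comp↓ (pair↓ (proj₁ (d n) a) (proj₂ (d′ n) ¬b)) (halts andʳ (1 ⊗ 0))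
      ... | no ¬a | yes b =
        comp↓ (pair↓ (proj₂ (d n) ¬a) (proj₁ (d′ n) b)) (halts andʳ (0 ⊗ 1))
      ... | no ¬a | no ¬b =
        comp↓ (pair↓ (proj₂ (d n) ¬a) (proj₂ (d′ n) ¬b)) (halts andʳ (0 ⊗ 0))

    module _ (A : ℕ → ℕ → Set) (A≤O : (λ n → A (π₁ n) (π₂ n)) ≤T O) where

      private
        at : ∀ n v → A (π₁ (n ⊗ v)) (π₂ (n ⊗ v)) ≡ A n v
        at n v = cong₂ A (π₁-⊗ n v) (π₂-⊗ n v)

      -- `μᶜ` looks for a zero, and the decider of the complement returns 0 where `A` holds.
      search : Code
      search = μᶜ (proj₁ (¬ᵈ A≤O))

      search-halts : ∀ {n} → ∃ (A n) → ∃[ v ] O ⊢ search · n ↓ v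
      search-halts {n} found with k , a , none ← least found =
        k , μ↓ (proj₂ (proj₂ (¬ᵈ A≤O) _) (contradiction (subst id (sym (at n k)) a)))
               (λ j j<k → 0 , proj₁ (proj₂ (¬ᵈ A≤O) _) (none j j<k ∘ subst id (at n j)))

      search-sound : ∀ {n v} → O ⊢ search · n ↓ v → A n v
      search-sound {n} {v} (μ↓ p _) = subst id (at n v) (stable λ ¬a →
        1+n≢0 (deterministic (proj₁ (¬ᵈ A≤O)) (proj₁ (proj₂ (¬ᵈ A≤O) _) ¬a) p))

      -- The existential statement is the halting of `search`, so one jump absorbs one unbounded
      -- quantifier.
      ∃≤T′ : (λ n → ∃ (A n)) ≤T O ′
      ∃≤T′ = ≤T-cast (λ n → mk⇔ (λ (v , p) → v , search-sound p) search-halts) (halting≤T′ search)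

    -- A search whose condition ignores the candidate stops at once if `A n` holds and never
    -- otherwise.
    ≤T⇒CE : {A : Pred ℕ 0ℓ} → A ≤T O → CE-in O A
    ≤T⇒CE {A} A≤O = search (λ n _ → A n) (A≤O ∘ᵈ fstʳ) , λ n → mk⇔
      (λ a → search-halts (λ n _ → A n) (A≤O ∘ᵈ fstʳ) (0 , a))
      (λ (_ , p) → search-sound (λ n _ → A n) (A≤O ∘ᵈ fstʳ) p)

    -- Where A fails the unbounded search is made to stop at once, so that the program is total
    -- as soon as A n implies ∃ (B n).
    choose : (A : Pred ℕ 0ℓ) (B : ℕ → ℕ → Set) {f : ℕ → ℕ → ℕ} {g : ℕ → ℕ} →
      A ≤T O → (λ n → B (π₁ n) (π₂ n)) ≤T O →
      Recursive O (λ n → f (π₁ n) (π₂ n)) → Recursive O g →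
      ∃[ c ] ∀ n → (A n → ∃ (B n) → ∃[ v ] (B n v × O ⊢ c · n ↓ f n v)) ×
                   (¬ A n → O ⊢ c · n ↓ g n)
    choose A B {f} {g} A≤O B≤O F G = chooseᶜ , λ n → onA n , off n
      where
      Stop : ℕ → ℕ → Set
      -- Classically `A n → B n v`, written with connectives that already have deciders.
      Stop n v = ¬ (A n × ¬ B n v)

      Stop≤O : (λ n → Stop (π₁ n) (π₂ n)) ≤T O
      Stop≤O = ¬ᵈ (A≤O ∘ᵈ fstʳ ×ᵈ ¬ᵈ B≤O)

      output : ∃[ c ] ∀ n → (A (π₁ n) → O ⊢ c · n ↓ f (π₁ n) (π₂ n)) ×
                            (¬ A (π₁ n) → O ⊢ c · n ↓ g (π₁ n))
      output = branch (A≤O ∘ᵈ fstʳ) F (G ∘ʳ fstʳ)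

      chooseᶜ : Code
      chooseᶜ = compᶜ (proj₁ output) (pairᶜ (program (idʳ {O})) (search Stop Stop≤O))

      run : ∀ {n v w} → O ⊢ search Stop Stop≤O · n ↓ v → O ⊢ proj₁ output · (n ⊗ v) ↓ w →
            O ⊢ chooseᶜ · n ↓ w
      run {n} p q = comp↓ (pair↓ (halts idʳ n) p) q

      onA : ∀ n → A n → ∃ (B n) → ∃[ v ] (B n v × O ⊢ chooseᶜ · n ↓ f n v)
      onA n a (w , b) with v , p ← search-halts Stop Stop≤O {n} (w , λ (_ , ¬b) → ¬b b) =
        v , stable (λ ¬b → search-sound Stop Stop≤O p (a , ¬b)) ,
        subst (O ⊢ chooseᶜ · n ↓_) (cong₂ f (π₁-⊗ n v) (π₂-⊗ n v))
          (run p (proj₁ (proj₂ output _) (subst A (sym (π₁-⊗ n v)) a)))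

      off : ∀ n → ¬ A n → O ⊢ chooseᶜ · n ↓ g n
      off n ¬a with v , p ← search-halts Stop Stop≤O {n} (0 , λ (a , _) → ¬a a) =
        subst (O ⊢ chooseᶜ · n ↓_) (cong g (π₁-⊗ n v))
          (run p (proj₂ (proj₂ output _) (¬a ∘ subst A (π₁-⊗ n v))))

  -- `O` is rewritten with a dummy existential quantifier.
  ≤T-jump : ∀ O → O ≤T O ′
  ≤T-jump O = ≤T-cast (λ n → mk⇔ proj₂ (0 ,_)) (∃≤T′ (λ n _ → O n) (query fstʳ))

-- Embeddings and amalgamation bases

module _ {L : Language} where
  open Structure
  open Embedding

  infixr 9 _∘ᵉ_
  _∘ᵉ_ : {A B C : Structure L} → Embedding B C → Embedding A B → Embedding A C
  (g ∘ᵉ f) .to                 = to g ∘ to f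
  (g ∘ᵉ f) .injective          = injective f ∘ injective g
  _∘ᵉ_ {C = C} g f .fun-hom F xs = trans (cong (to g) (fun-hom f F xs))
    (trans (fun-hom g F (map (to f) xs)) (cong (fun C F) (sym (map-∘ (to g) (to f) xs))))
  _∘ᵉ_ {C = C} g f .rel-hom R xs rewrite map-∘ (to g) (to f) xs = mk⇔
    (Equivalence.to (rel-hom g R (map (to f) xs)) ∘ Equivalence.to (rel-hom f R xs))
    (Equivalence.from (rel-hom f R xs) ∘ Equivalence.from (rel-hom g R (map (to f) xs)))

  -- Every element is the value of a term at the generators, and embeddings commute with evaluation.
  embeddings-agree : {A B : Structure L} (g h : Embedding A B)
    {n : ℕ} {a : Vec (Carrier A) n} → GeneratedBy A a →
    map (to g) a ≡ map (to h) a → ∀ x → to g x ≡ to h x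
  embeddings-agree {A} {B} g h {a = a} generated e x = begin
    to g x                    ≡⟨ cong (to g) (eval-term (generated x)) ⟨
    to g (eval A a t)         ≡⟨ to-eval g a t ⟩
    eval B (map (to g) a) t   ≡⟨ cong (λ b → eval B b t) e ⟩
    eval B (map (to h) a) t   ≡⟨ to-eval h a t ⟨
    to h (eval A a t)         ≡⟨ cong (to h) (eval-term (generated x)) ⟩
    to h x                    ∎
    where
    open ≡-Reasoning
    t = term (generated x)

  module _ {A : Structure L} {m n} {a : Vec (Carrier A) n} (c : Vec (Carrier A) m) where

    Cl-++ʳ  : ∀ {x} → Cl A a x → Cl A (c ++ a) x
    Cls-++ʳ : ∀ {k} {xs : Vec (Carrier A) k} → All (Cl A a) xs → All (Cl A (c ++ a)) xs
    Cl-++ʳ (gen k)    = subst (Cl A (c ++ a)) (lookup-++ʳ c a k) (gen (m ↑ʳ k))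
    Cl-++ʳ (app F ps) = app F (Cls-++ʳ ps)
    Cls-++ʳ []        = []
    Cls-++ʳ (p ∷ ps)  = Cl-++ʳ p ∷ Cls-++ʳ ps

  -- `c ++ a` still generates `A`, so a single embedding controls the images of both `c` and `a`.
  -- This turns equality of composites into a condition on atomic types.
  extend-++ : {A B : Structure L} {m n : ℕ} {a : Vec (Carrier A) n} → GeneratedBy A a →
    (c : Vec (Carrier A) m) {e : Vec (Carrier B) m} {d : Vec (Carrier B) n} →
    SameAtomicType A B (c ++ a) (e ++ d) →
    Σ[ g ∈ Embedding A B ] (map (to g) c ≡ e × map (to g) a ≡ d)
  extend-++ {a = a} generated c {e} same =
    g , ++-injective (map (to g) c) e
      (trans (sym (map-++ (to g) c a)) (extend-generators (Cl-++ʳ c ∘ generated) same))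
    where g = extend (Cl-++ʳ c ∘ generated) same

  -- A span over `B` is pulled back along `σ`. Surjectivity of `σ` carries commutation over `A` to
  -- every element of `B`.
  base-≅ : ∀ {K A B} → IsAmalgamationBase K A → K B → A ≅ B → IsAmalgamationBase K B
  base-≅ (_ , amalgamate) KB (σ , onto) = KB , λ KC KD f g →
    let E , KE , α , β , commutes = amalgamate KC KD (f ∘ᵉ σ) (g ∘ᵉ σ)
    in  E , KE , α , β , λ y →
          let x , σx≡y = onto y
          in  subst (λ z → to α (to f z) ≡ to β (to g z)) (σx≡y refl) (commutes x)

  -- A code determines the length as well, which matters for ranges of unconstrained length.
  -- Irrelevance of membership makes elements with equal values equal.
  values-injective : {𝓜 : ωStructure L} {m n : ℕ}
    (a : Vec (ωStructure.Element 𝓜) m) (b : Vec (ωStructure.Element 𝓜) n) →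
    tupleᴹ 𝓜 a ≡ tupleᴹ 𝓜 b → (m , a) ≡ (n , b)
  values-injective []       []       _ = refl
  values-injective {𝓜} ((x Refinement., _) ∷ a) ((y Refinement., _) ∷ b) e
    with x≡y , a≡b ← ⊗-injective {x} {tupleᴹ 𝓜 a} {y} {tupleᴹ 𝓜 b} (suc-injective e)
    with refl ← values-injective {𝓜} a b a≡b | refl ← x≡y = refl

  tupleᴹ-injective : {𝓜 : ωStructure L} {n : ℕ} (a b : Vec (ωStructure.Element 𝓜) n) →
    tupleᴹ 𝓜 a ≡ tupleᴹ 𝓜 b → a ≡ b
  tupleᴹ-injective {𝓜} a b e with refl ← values-injective {𝓜} a b e = refl

-- Embeddings as queries to the embedding information

module _ {L : Language} (𝕂 : ComputableAge L) where
  open ComputableAge 𝕂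
  open Structure
  open Embedding

  private
    Elem : ℕ → Set
    Elem i = ωStructure.Element (𝒜 i)

    ⟦_∣_⟧ : ∀ i {n} → Vec (Elem i) n → ℕ
    ⟦ i ∣ b ⟧ = tupleᴹ (𝒜 i) b

    Same : ∀ i j {n} → Vec (Elem i) n → Vec (Elem j) n → Set
    Same i j = SameAtomicType (𝓢 i) (𝓢 j)

  𝕀-injective : ∀ {i j} → 𝕀 i ≡ 𝕀 j → i ≡ j
  𝕀-injective {i} {j} e = proj₂ (⊗-injective {index i} {i} {index j} {j}
    (proj₂ (⊗-injective {⟦ i ∣ gens i ⟧} {index i ⊗ i} {⟦ j ∣ gens j ⟧} {index j ⊗ j} e)))

  π₁-𝕀 : ∀ i → π₁ (𝕀 i) ≡ ⟦ i ∣ gens i ⟧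
  π₁-𝕀 i = π₁-⊗ ⟦ i ∣ gens i ⟧ (index i ⊗ i)

  -- Decodes an unknown `r`: the members of `EI` are built from genuine indices and tuples, and the
  -- known first half fixes `i` and the length.
  EI-codomain : ∀ {i n r} {b : Vec (Elem i) n} → EI 𝕂 (𝕀 i ⊗ ⟦ i ∣ b ⟧ ⊗ r) →
    ∃[ j ] Σ[ c ∈ Vec (Elem j) n ] (r ≡ 𝕀 j ⊗ ⟦ j ∣ c ⟧ × Same i j b c)
  EI-codomain {i} {n} {r} {b} (i′ , j , n′ , b′ , c , same , e)
    with e₁ , e₂ ← ⊗-injective {𝕀 i′} {⟦ i′ ∣ b′ ⟧ ⊗ 𝕀 j ⊗ ⟦ j ∣ c ⟧} {𝕀 i} {⟦ i ∣ b ⟧ ⊗ r} e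
    with refl ← 𝕀-injective {i′} {i} e₁
    with e₃ , e₄ ← ⊗-injective {⟦ i ∣ b′ ⟧} {𝕀 j ⊗ ⟦ j ∣ c ⟧} {⟦ i ∣ b ⟧} {r} e₂
    with refl ← values-injective {𝓜 = 𝒜 i} b′ b e₃ = j , c , sym e₄ , same

  EI-range : ∀ {i j n t} {b : Vec (Elem i) n} → EI 𝕂 (𝕀 i ⊗ ⟦ i ∣ b ⟧ ⊗ 𝕀 j ⊗ t) →
    Σ[ c ∈ Vec (Elem j) n ] (t ≡ ⟦ j ∣ c ⟧ × Same i j b c)
  EI-range {i} {j} {n} {t} {b} ei
    with j′ , c , e , same ← EI-codomain {i} {r = 𝕀 j ⊗ t} {b} ei
    with e₁ , e₂ ← ⊗-injective {𝕀 j} {t} {𝕀 j′} {⟦ j′ ∣ c ⟧} e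
    with refl ← 𝕀-injective {j} {j′} e₁ = c , e₂ , same

  EI-same : ∀ {i j n} {b : Vec (Elem i) n} {c : Vec (Elem j) n} →
    EI 𝕂 (𝕀 i ⊗ ⟦ i ∣ b ⟧ ⊗ 𝕀 j ⊗ ⟦ j ∣ c ⟧) → Same i j b c
  EI-same {i} {j} {b = b} {c} ei = unique (EI-range {i} {j} {t = ⟦ j ∣ c ⟧} {b} ei)
    where
    unique : Σ[ c′ ∈ Vec (Elem j) _ ] (⟦ j ∣ c ⟧ ≡ ⟦ j ∣ c′ ⟧ × Same i j b c′) → Same i j b c
    unique (c′ , e , same) = subst (Same i j b) (sym (tupleᴹ-injective {𝓜 = 𝒜 j} c c′ e)) same

  same-EI : ∀ {i j n} {b : Vec (Elem i) n} {c : Vec (Elem j) n} → Same i j b c →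
    EI 𝕂 (𝕀 i ⊗ ⟦ i ∣ b ⟧ ⊗ 𝕀 j ⊗ ⟦ j ∣ c ⟧)
  same-EI {i} {j} {n} {b} {c} same = i , j , n , b , c , same , refl

  -- x is some 𝕀 i, with π₁ x the code of its generators, and r is 𝕀 j ⊗ ⟦ j ∣ c ⟧ for some
  -- embedding (𝕀 i , 𝕀 j , c).
  record CodedEmb (x r : ℕ) : Set where
    constructor coded
    field ei : EI 𝕂 (x ⊗ π₁ x ⊗ r)

  codedEmb⁺ : ∀ {i j} {c : Vec (Elem j) (rank i)} → Same i j (gens i) c →
              CodedEmb (𝕀 i) (𝕀 j ⊗ ⟦ j ∣ c ⟧)
  codedEmb⁺ {i} {j} {c} same = coded (subst (λ t → EI 𝕂 (𝕀 i ⊗ t ⊗ 𝕀 j ⊗ ⟦ j ∣ c ⟧)) (sym (π₁-𝕀 i))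
    (same-EI {i} {j} {b = gens i} {c} same))

  codedEmb-domain : ∀ {x r} → CodedEmb x r → ∃[ i ] x ≡ 𝕀 i
  codedEmb-domain {x} {r} (coded (i , j , _ , b , c , _ , e)) =
    i , sym (proj₁ (⊗-injective {𝕀 i} {⟦ i ∣ b ⟧ ⊗ 𝕀 j ⊗ ⟦ j ∣ c ⟧} {x} {π₁ x ⊗ r} e))

  codedEmb-EI : ∀ {i r} → CodedEmb (𝕀 i) r → EI 𝕂 (𝕀 i ⊗ ⟦ i ∣ gens i ⟧ ⊗ r)
  codedEmb-EI {i} {r} (coded ei) = subst (λ t → EI 𝕂 (𝕀 i ⊗ t ⊗ r)) (π₁-𝕀 i) ei

  codedEmb-codomain : ∀ {i r} → CodedEmb (𝕀 i) r →
    ∃[ j ] Σ[ c ∈ Vec (Elem j) (rank i) ] (r ≡ 𝕀 j ⊗ ⟦ j ∣ c ⟧ × Same i j (gens i) c)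
  codedEmb-codomain {i} {r} p = EI-codomain {i} {r = r} {gens i} (codedEmb-EI {i} {r} p)

  codedEmb-range : ∀ {i j t} → CodedEmb (𝕀 i) (𝕀 j ⊗ t) →
    Σ[ c ∈ Vec (Elem j) (rank i) ] (t ≡ ⟦ j ∣ c ⟧ × Same i j (gens i) c)
  codedEmb-range {i} {j} {t} p = EI-range {i} {j} {t = t} {gens i} (codedEmb-EI {i} {𝕀 j ⊗ t} p)

  -- For r coding (𝕀 k , c): some embedding of 𝓢 k into q maps gens k to d and c to e.
  record CodedExtension (r q e d : ℕ) : Set where
    constructor coded
    field ei : EI 𝕂 (π₁ r ⊗ append (π₂ r) (π₁ (π₁ r)) ⊗ q ⊗ append e d)

  append-⟦⟧ : ∀ {i m n} (b : Vec (Elem i) m) (c : Vec (Elem i) n) →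
              append ⟦ i ∣ b ⟧ ⟦ i ∣ c ⟧ ≡ ⟦ i ∣ b ++ c ⟧
  append-⟦⟧ {i} b c = trans (append-tuple (map value b) (map value c)) (cong tuple (sym (map-++ value b c)))

  codedExtension-code : ∀ {k l m} (c : Vec (Elem k) m) (e : Vec (Elem l) m) (d : Vec (Elem l) (rank k)) →
    let r = 𝕀 k ⊗ ⟦ k ∣ c ⟧ in
    π₁ r ⊗ append (π₂ r) (π₁ (π₁ r)) ⊗ 𝕀 l ⊗ append ⟦ l ∣ e ⟧ ⟦ l ∣ d ⟧ ≡
    𝕀 k ⊗ ⟦ k ∣ c ++ gens k ⟧ ⊗ 𝕀 l ⊗ ⟦ l ∣ e ++ d ⟧
  codedExtension-code {k} {l} c e d = cong₂ _⊗_ (π₁-⊗ (𝕀 k) ⟦ k ∣ c ⟧) (cong₂ _⊗_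
    (trans (cong₂ append (π₂-⊗ (𝕀 k) ⟦ k ∣ c ⟧) (trans (cong π₁ (π₁-⊗ (𝕀 k) ⟦ k ∣ c ⟧)) (π₁-𝕀 k)))
           (append-⟦⟧ {k} c (gens k)))
    (cong (𝕀 l ⊗_) (append-⟦⟧ {l} e d)))

  codedExtension⁺ : ∀ {k l m} {c : Vec (Elem k) m} {e : Vec (Elem l) m} {d : Vec (Elem l) (rank k)} →
    Same k l (c ++ gens k) (e ++ d) →
    CodedExtension (𝕀 k ⊗ ⟦ k ∣ c ⟧) (𝕀 l) ⟦ l ∣ e ⟧ ⟦ l ∣ d ⟧
  codedExtension⁺ {k} {l} {c = c} {e} {d} same =
    coded (subst (EI 𝕂) (sym (codedExtension-code {k} {l} c e d))
      (same-EI {k} {l} {b = c ++ gens k} {e ++ d} same))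

  codedExtension⁻ : ∀ {k l m} {c : Vec (Elem k) m} {e : Vec (Elem l) m} {d : Vec (Elem l) (rank k)} →
    CodedExtension (𝕀 k ⊗ ⟦ k ∣ c ⟧) (𝕀 l) ⟦ l ∣ e ⟧ ⟦ l ∣ d ⟧ →
    Same k l (c ++ gens k) (e ++ d)
  codedExtension⁻ {k} {l} {c = c} {e} {d} (coded ei) =
    EI-same {k} {l} {b = c ++ gens k} {e ++ d} (subst (EI 𝕂) (codedExtension-code {k} {l} c e d) ei)

  -- Coded spans and amalgams

  Span : ℕ → ℕ → ℕ → Set
  Span y r₀ r₁ = CodedEmb y r₀ × CodedEmb y r₁

  -- The first conjunct decodes `d` as a tuple of the right length in the right structure; the
  -- second can then be read as an equality of atomic types.
  CodedLeg : ℕ → ℕ → ℕ → ℕ → Set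
  CodedLeg r q e d = CodedEmb (π₁ r) (q ⊗ d) × CodedExtension r q e d

  -- v is q ⊗ e ⊗ d₀ ⊗ d₁, where e is the common image in q of the generators of y.
  CodedAmalgam : ℕ → ℕ → ℕ → ℕ → Set
  CodedAmalgam y r₀ r₁ v =
    CodedEmb y (π₁ v ⊗ π₁ (π₂ v)) ×
    CodedLeg r₀ (π₁ v) (π₁ (π₂ v)) (π₁ (π₂ (π₂ v))) ×
    CodedLeg r₁ (π₁ v) (π₁ (π₂ v)) (π₂ (π₂ (π₂ v)))

  record Amalgam {j k₀ k₁} (c₀ : Vec (Elem k₀) (rank j)) (c₁ : Vec (Elem k₁) (rank j)) : Set where
    field
      l    : ℕ
      e    : Vec (Elem l) (rank j)
      d₀   : Vec (Elem l) (rank k₀)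
      d₁   : Vec (Elem l) (rank k₁)
      base : Same j l (gens j) e
      emb₀ : Same k₀ l (gens k₀) d₀
      emb₁ : Same k₁ l (gens k₁) d₁
      ext₀ : Same k₀ l (c₀ ++ gens k₀) (e ++ d₀)
      ext₁ : Same k₁ l (c₁ ++ gens k₁) (e ++ d₁)

    code : ℕ
    code = 𝕀 l ⊗ ⟦ l ∣ e ⟧ ⊗ ⟦ l ∣ d₀ ⟧ ⊗ ⟦ l ∣ d₁ ⟧

  codedLeg⁺ : ∀ {k l m} {c : Vec (Elem k) m} {e : Vec (Elem l) m} {d : Vec (Elem l) (rank k)} →
    Same k l (gens k) d → Same k l (c ++ gens k) (e ++ d) →
    CodedLeg (𝕀 k ⊗ ⟦ k ∣ c ⟧) (𝕀 l) ⟦ l ∣ e ⟧ ⟦ l ∣ d ⟧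
  codedLeg⁺ {k} {l} {c = c} {e} {d} same extends =
    subst (λ x → CodedEmb x (𝕀 l ⊗ ⟦ l ∣ d ⟧)) (sym (π₁-⊗ (𝕀 k) ⟦ k ∣ c ⟧)) (codedEmb⁺ {k} {l} {d} same) ,
    codedExtension⁺ {k} {l} {c = c} {e} {d} extends

  codedLeg⁻ : ∀ {k l m t} {c : Vec (Elem k) m} {e : Vec (Elem l) m} →
    CodedLeg (𝕀 k ⊗ ⟦ k ∣ c ⟧) (𝕀 l) ⟦ l ∣ e ⟧ t →
    Σ[ d ∈ Vec (Elem l) (rank k) ]
      (t ≡ ⟦ l ∣ d ⟧ × Same k l (gens k) d × Same k l (c ++ gens k) (e ++ d))
  codedLeg⁻ {k} {l} {t = t} {c} {e} (emb , ext) =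
    extension (codedEmb-range {k} {l} {t}
      (subst (λ x → CodedEmb x (𝕀 l ⊗ t)) (π₁-⊗ (𝕀 k) ⟦ k ∣ c ⟧) emb))
    where
    extension : Σ[ d ∈ Vec (Elem l) (rank k) ] (t ≡ ⟦ l ∣ d ⟧ × Same k l (gens k) d) →
      Σ[ d ∈ Vec (Elem l) (rank k) ]
        (t ≡ ⟦ l ∣ d ⟧ × Same k l (gens k) d × Same k l (c ++ gens k) (e ++ d))
    extension (d , t≡d , same) = d , t≡d , same , codedExtension⁻ {k} {l} {c = c} {e} {d}
      (subst (CodedExtension (𝕀 k ⊗ ⟦ k ∣ c ⟧) (𝕀 l) ⟦ l ∣ e ⟧) t≡d ext)

  module _ {j k₀ k₁} {c₀ : Vec (Elem k₀) (rank j)} {c₁ : Vec (Elem k₁) (rank j)} where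

    codedAmalgam⁺ : (A : Amalgam c₀ c₁) →
      CodedAmalgam (𝕀 j) (𝕀 k₀ ⊗ ⟦ k₀ ∣ c₀ ⟧) (𝕀 k₁ ⊗ ⟦ k₁ ∣ c₁ ⟧) (Amalgam.code A)
    codedAmalgam⁺ A = fromComponents (𝕀 l) ⟦ l ∣ e ⟧ ⟦ l ∣ d₀ ⟧ ⟦ l ∣ d₁ ⟧
      (codedEmb⁺ {j} {l} {e} base)
      (codedLeg⁺ {k₀} {l} {c = c₀} {e} {d₀} emb₀ ext₀)
      (codedLeg⁺ {k₁} {l} {c = c₁} {e} {d₁} emb₁ ext₁)
      where
      open Amalgam A
      -- With variables for the four components, the unpairing equations rewrite exactly the
      -- projections of the amalgam code.
      fromComponents : ∀ {y r₀ r₁} q t t₀ t₁ → CodedEmb y (q ⊗ t) →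
        CodedLeg r₀ q t t₀ → CodedLeg r₁ q t t₁ → CodedAmalgam y r₀ r₁ (q ⊗ t ⊗ t₀ ⊗ t₁)
      fromComponents q t t₀ t₁ emb leg₀ leg₁
        rewrite unpair-⊗ q (t ⊗ t₀ ⊗ t₁) | unpair-⊗ t (t₀ ⊗ t₁) | unpair-⊗ t₀ t₁ =
        emb , leg₀ , leg₁

    codedAmalgam⁻ : ∀ {v} → CodedAmalgam (𝕀 j) (𝕀 k₀ ⊗ ⟦ k₀ ∣ c₀ ⟧) (𝕀 k₁ ⊗ ⟦ k₁ ∣ c₁ ⟧) v →
      Σ[ A ∈ Amalgam c₀ c₁ ] v ≡ Amalgam.code A
    codedAmalgam⁻ {v} (emb , leg₀ , leg₁) =
      fromComponents (π₁ v) (π₁ (π₂ v)) (π₁ (π₂ (π₂ v))) (π₂ (π₂ (π₂ v))) (unpair⁴ v) emb leg₀ leg₁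
      where
      unpair⁴ : ∀ v → v ≡ π₁ v ⊗ π₁ (π₂ v) ⊗ π₁ (π₂ (π₂ v)) ⊗ π₂ (π₂ (π₂ v))
      unpair⁴ v = trans (sym (⊗-unpair v)) (cong (π₁ v ⊗_) (trans (sym (⊗-unpair (π₂ v)))
        (cong (π₁ (π₂ v) ⊗_) (sym (⊗-unpair (π₂ (π₂ v)))))))

      r₀ = 𝕀 k₀ ⊗ ⟦ k₀ ∣ c₀ ⟧
      r₁ = 𝕀 k₁ ⊗ ⟦ k₁ ∣ c₁ ⟧

      Leg : ∀ {k l} → Vec (Elem k) (rank j) → Vec (Elem l) (rank j) → ℕ → Set
      Leg {k} {l} c e t = Σ[ d ∈ Vec (Elem l) (rank k) ]
        (t ≡ ⟦ l ∣ d ⟧ × Same k l (gens k) d × Same k l (c ++ gens k) (e ++ d))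

      module _ (q t t₀ t₁ : ℕ) (v≡ : v ≡ q ⊗ t ⊗ t₀ ⊗ t₁) where

        fromLegs : ∀ {l} {e : Vec (Elem l) (rank j)} → q ≡ 𝕀 l → t ≡ ⟦ l ∣ e ⟧ →
          Same j l (gens j) e → Leg {k₀} {l} c₀ e t₀ → Leg {k₁} {l} c₁ e t₁ →
          Σ[ A ∈ Amalgam c₀ c₁ ] v ≡ Amalgam.code A
        fromLegs {l} {e} q≡ t≡ base (d₀ , t₀≡ , emb₀ , ext₀) (d₁ , t₁≡ , emb₁ , ext₁) =
          record { l = l ; e = e ; d₀ = d₀ ; d₁ = d₁
                 ; base = base ; emb₀ = emb₀ ; emb₁ = emb₁ ; ext₀ = ext₀ ; ext₁ = ext₁ } ,
          trans v≡ (cong₂ _⊗_ q≡ (cong₂ _⊗_ t≡ (cong₂ _⊗_ t₀≡ t₁≡)))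

        fromBase : CodedLeg r₀ q t t₀ → CodedLeg r₁ q t t₁ →
          (∃[ l ] Σ[ e ∈ Vec (Elem l) (rank j) ] (q ⊗ t ≡ 𝕀 l ⊗ ⟦ l ∣ e ⟧ × Same j l (gens j) e)) →
          Σ[ A ∈ Amalgam c₀ c₁ ] v ≡ Amalgam.code A
        fromBase leg₀ leg₁ (l , e , qt≡ , base) = fromLegs {l} {e} q≡ t≡ base
          (codedLeg⁻ {k₀} {l} {t = t₀} {c₀} {e} (subst₂ (λ q t → CodedLeg r₀ q t t₀) q≡ t≡ leg₀))
          (codedLeg⁻ {k₁} {l} {t = t₁} {c₁} {e} (subst₂ (λ q t → CodedLeg r₁ q t t₁) q≡ t≡ leg₁))
          where
          q≡ : q ≡ 𝕀 l
          q≡ = proj₁ (⊗-injective {q} {t} {𝕀 l} {⟦ l ∣ e ⟧} qt≡)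
          t≡ : t ≡ ⟦ l ∣ e ⟧
          t≡ = proj₂ (⊗-injective {q} {t} {𝕀 l} {⟦ l ∣ e ⟧} qt≡)

        fromComponents : CodedEmb (𝕀 j) (q ⊗ t) → CodedLeg r₀ q t t₀ → CodedLeg r₁ q t t₁ →
          Σ[ A ∈ Amalgam c₀ c₁ ] v ≡ Amalgam.code A
        fromComponents emb leg₀ leg₁ = fromBase leg₀ leg₁ (codedEmb-codomain {j} {q ⊗ t} emb)

    -- Both composites send `gens j` to `e`, and these generate `𝓢 j`.
    amalgam-commutes : (A : Amalgam c₀ c₁) → let open Amalgam A in
      (f₀ : Embedding (𝓢 j) (𝓢 k₀)) (f₁ : Embedding (𝓢 j) (𝓢 k₁))
      (g₀ : Embedding (𝓢 k₀) (𝓢 l)) (g₁ : Embedding (𝓢 k₁) (𝓢 l)) →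
      map (to f₀) (gens j) ≡ c₀ → map (to f₁) (gens j) ≡ c₁ →
      map (to g₀) (gens k₀) ≡ d₀ → map (to g₁) (gens k₁) ≡ d₁ →
      ∀ x → to g₀ (to f₀ x) ≡ to g₁ (to f₁ x)
    amalgam-commutes A f₀ f₁ g₀ g₁ f₀≡ f₁≡ g₀≡ g₁≡ =
      embeddings-agree (g₀ ∘ᵉ f₀) (g₁ ∘ᵉ f₁) (generated j)
        (trans (image c₀ f₀ g₀ f₀≡ g₀≡ ext₀) (sym (image c₁ f₁ g₁ f₁≡ g₁≡ ext₁)))
      where
      open Amalgam A
      image : ∀ {k} (c : Vec (Elem k) (rank j)) {d : Vec (Elem l) (rank k)}
        (f : Embedding (𝓢 j) (𝓢 k)) (g : Embedding (𝓢 k) (𝓢 l)) →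
        map (to f) (gens j) ≡ c → map (to g) (gens k) ≡ d →
        Same k l (c ++ gens k) (e ++ d) → map (to g ∘ to f) (gens j) ≡ e
      -- The embedding `h` given by the extension condition sends `c` to `e`; it agrees with `g` on
      -- `gens k`, hence everywhere.
      image {k} c f g f≡ g≡ ext with h , hc≡ , h≡ ← extend-++ (generated k) c {e} ext = begin
        map (to g ∘ to f) (gens j)      ≡⟨ map-∘ (to g) (to f) (gens j) ⟩
        map (to g) (map (to f) (gens j)) ≡⟨ cong (map (to g)) f≡ ⟩
        map (to g) c ≡⟨ map-cong (embeddings-agree g h (generated k) (trans g≡ (sym h≡))) c ⟩
        map (to h) c ≡⟨ hc≡ ⟩
        e ∎
        where
        open ≡-Reasoning

    -- The amalgam `D` is carried into some `𝓢 l` by `exhaustive`, and all tuples are images under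
    -- the resulting maps. That `e` is also the image of `c₁` is the commutation of the square
    -- (`images`).
    base-amalgam : IsAmalgamationBase K (𝓢 j) →
      Same j k₀ (gens j) c₀ → Same j k₁ (gens j) c₁ → Amalgam c₀ c₁
    base-amalgam (_ , amalgamate) same₀ same₁
      with D , KD , α , β , commutes ←
             amalgamate (𝓢∈K k₀) (𝓢∈K k₁) (extend (generated j) same₀) (extend (generated j) same₁)
      with l , δ , _ ← exhaustive KD = record
        { l    = l
        ; e    = map (to δα) c₀
        ; d₀   = map (to δα) (gens k₀)
        ; d₁   = map (to δβ) (gens k₁)
        ; base = subst (Same j l (gens j))
            (trans (map-∘ (to δα) (to f₀) (gens j)) (cong (map (to δα)) f₀≡))
            (embedding-preserves-type (δα ∘ᵉ f₀) (gens j))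
        ; emb₀ = embedding-preserves-type δα (gens k₀)
        ; emb₁ = embedding-preserves-type δβ (gens k₁)
        ; ext₀ = subst (Same k₀ l (c₀ ++ gens k₀)) (map-++ (to δα) c₀ (gens k₀))
            (embedding-preserves-type δα (c₀ ++ gens k₀))
        ; ext₁ = subst (Same k₁ l (c₁ ++ gens k₁))
            (trans (map-++ (to δβ) c₁ (gens k₁)) (cong (_++ map (to δβ) (gens k₁)) images))
            (embedding-preserves-type δβ (c₁ ++ gens k₁))
        }
      where
      δα = δ ∘ᵉ α
      δβ = δ ∘ᵉ β
      f₀ = extend (generated j) same₀
      f₁ = extend (generated j) same₁
      f₀≡ = extend-generators (generated j) same₀
      f₁≡ = extend-generators (generated j) same₁

      open ≡-Reasoning
      images : map (to δβ) c₁ ≡ map (to δα) c₀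
      images = begin
        map (to δβ) c₁                      ≡⟨ cong (map (to δβ)) f₁≡ ⟨
        map (to δβ) (map (to f₁) (gens j))  ≡⟨ map-∘ (to δβ) (to f₁) (gens j) ⟨
        map (to δβ ∘ to f₁) (gens j)        ≡⟨ map-cong (λ x → cong (to δ) (sym (commutes x))) (gens j) ⟩
        map (to δα ∘ to f₀) (gens j)        ≡⟨ map-∘ (to δα) (to f₀) (gens j) ⟩
        map (to δα) (map (to f₀) (gens j))  ≡⟨ cong (map (to δα)) f₀≡ ⟩
        map (to δα) c₀                      ∎

  -- Arbitrary members of `K` are first replaced by their copies in the enumeration, so amalgamating
  -- spans between listed structures is enough.
  amalgams-base : ∀ {j} →
    (∀ {k₀ k₁} (c₀ : Vec (Elem k₀) (rank j)) (c₁ : Vec (Elem k₁) (rank j)) →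
      Same j k₀ (gens j) c₀ → Same j k₁ (gens j) c₁ → Amalgam c₀ c₁) →
    IsAmalgamationBase K (𝓢 j)
  amalgams-base {j} amalgam = 𝓢∈K j , λ KB KC f g →
    let k₀ , β , _ = exhaustive KB
        k₁ , γ , _ = exhaustive KC
        f₀ = β ∘ᵉ f
        f₁ = γ ∘ᵉ g
        A  = amalgam (map (to f₀) (gens j)) (map (to f₁) (gens j))
               (embedding-preserves-type f₀ (gens j)) (embedding-preserves-type f₁ (gens j))
        open Amalgam A
        g₀ = extend (generated k₀) emb₀
        g₁ = extend (generated k₁) emb₁
    in  𝓢 l , 𝓢∈K l , g₀ ∘ᵉ β , g₁ ∘ᵉ γ ,
        amalgam-commutes A f₀ f₁ g₀ g₁ refl refl
          (extend-generators (generated k₀) emb₀) (extend-generators (generated k₁) emb₁)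

-- Deciding amalgamation bases and finding diagrams

  module _ (em : ExcludedMiddle 0ℓ) where
    open Classical em

    private
      O : Pred ℕ 0ℓ
      O = EI 𝕂

    codedEmbᵈ : ∀ {x r} → Recursive O x → Recursive O r → (λ n → CodedEmb (x n) (r n)) ≤T O
    codedEmbᵈ {x} {r} X R = ≤T-cast (λ n → mk⇔ coded CodedEmb.ei) (query (X ⊗ʳ (fstʳ ∘ʳ X) ⊗ʳ R))

    spanᵈ : ∀ {y r₀ r₁} → Recursive O y → Recursive O r₀ → Recursive O r₁ →
            (λ n → Span (y n) (r₀ n) (r₁ n)) ≤T O
    spanᵈ Y R₀ R₁ = codedEmbᵈ Y R₀ ×ᵈ codedEmbᵈ Y R₁

    codedLegᵈ : ∀ {r q e d} → Recursive O r → Recursive O q → Recursive O e → Recursive O d →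
                (λ n → CodedLeg (r n) (q n) (e n) (d n)) ≤T O
    codedLegᵈ R Q E D = codedEmbᵈ (fstʳ ∘ʳ R) (Q ⊗ʳ D) ×ᵈ ≤T-cast (λ n → mk⇔ coded CodedExtension.ei)
      (query ((fstʳ ∘ʳ R) ⊗ʳ appendʳ (sndʳ ∘ʳ R) (fstʳ ∘ʳ fstʳ ∘ʳ R) ⊗ʳ Q ⊗ʳ appendʳ E D))

    codedAmalgamᵈ : ∀ {y r₀ r₁ v} → Recursive O y → Recursive O r₀ → Recursive O r₁ → Recursive O v →
                    (λ n → CodedAmalgam (y n) (r₀ n) (r₁ n) (v n)) ≤T O
    codedAmalgamᵈ Y R₀ R₁ V =
      codedEmbᵈ Y ((fstʳ ∘ʳ V) ⊗ʳ E) ×ᵈ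
      codedLegᵈ R₀ (fstʳ ∘ʳ V) E (fstʳ ∘ʳ sndʳ ∘ʳ sndʳ ∘ʳ V) ×ᵈ
      codedLegᵈ R₁ (fstʳ ∘ʳ V) E (sndʳ ∘ʳ sndʳ ∘ʳ sndʳ ∘ʳ V)
      where E = fstʳ ∘ʳ sndʳ ∘ʳ V

    Unamalgamated : ℕ → ℕ → Set
    Unamalgamated y s = Span y (π₁ s) (π₂ s) × ¬ ∃ (CodedAmalgam y (π₁ s) (π₂ s))

    CodedBase : ℕ → Set
    CodedBase y = ¬ ∃ (Unamalgamated y)

    -- The search for an amalgam costs the first jump and the search for an unamalgamated span the
    -- second. `Span` is lifted to the first jump to be combined with the inner quantifier.
    codedBase≤T : CodedBase ≤T O ′ ′
    codedBase≤T = ¬ᵈ (∃≤T′ Unamalgamated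
      (≤T-trans (spanᵈ fstʳ (fstʳ ∘ʳ sndʳ) (sndʳ ∘ʳ sndʳ)) (≤T-jump O) ×ᵈ
       ¬ᵈ (∃≤T′ (λ n → CodedAmalgam (π₁ n) (π₁ (π₂ n)) (π₂ (π₂ n)))
            (codedAmalgamᵈ (fstʳ ∘ʳ fstʳ) (fstʳ ∘ʳ sndʳ ∘ʳ fstʳ) (sndʳ ∘ʳ sndʳ ∘ʳ fstʳ) sndʳ))))

    base-codedAmalgam : ∀ {j r₀ r₁} → IsAmalgamationBase K (𝓢 j) → Span (𝕀 j) r₀ r₁ →
                        ∃ (CodedAmalgam (𝕀 j) r₀ r₁)
    base-codedAmalgam {j} {r₀} {r₁} base (emb₀ , emb₁) =
      amalgamate (codedEmb-codomain {j} {r₀} emb₀) (codedEmb-codomain {j} {r₁} emb₁)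
      where
      Codomain : ℕ → Set
      Codomain r = ∃[ k ] Σ[ c ∈ Vec (Elem k) (rank j) ] (r ≡ 𝕀 k ⊗ ⟦ k ∣ c ⟧ × Same j k (gens j) c)

      amalgamate : Codomain r₀ → Codomain r₁ → ∃ (CodedAmalgam (𝕀 j) r₀ r₁)
      amalgamate (k₀ , c₀ , r₀≡ , same₀) (k₁ , c₁ , r₁≡ , same₁) =
        Amalgam.code A , subst₂ (λ r₀ r₁ → CodedAmalgam (𝕀 j) r₀ r₁ (Amalgam.code A))
          (sym r₀≡) (sym r₁≡) (codedAmalgam⁺ A)
        where
        A : Amalgam {j} c₀ c₁
        A = base-amalgam base same₀ same₁

    codedBase⁺ : ∀ {j} → IsAmalgamationBase K (𝓢 j) → CodedBase (𝕀 j)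
    codedBase⁺ {j} base (s , span , none) = none (base-codedAmalgam {j} {π₁ s} {π₂ s} base span)

    -- `CodedBase` only denies a counterexample, so the amalgam is obtained by excluded middle.
    codedBase-amalgam : ∀ {y r₀ r₁} → CodedBase y → Span y r₀ r₁ → ∃ (CodedAmalgam y r₀ r₁)
    codedBase-amalgam {y} {r₀} {r₁} base span = stable λ none → base (r₀ ⊗ r₁ ,
      subst₂ (λ r₀ r₁ → Span y r₀ r₁ × ¬ ∃ (CodedAmalgam y r₀ r₁))
        (sym (π₁-⊗ r₀ r₁)) (sym (π₂-⊗ r₀ r₁)) (span , none))

    codedBase⁻ : ∀ {j} → CodedBase (𝕀 j) → IsAmalgamationBase K (𝓢 j)
    codedBase⁻ {j} base = amalgams-base λ {k₀} {k₁} c₀ c₁ same₀ same₁ →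
      decoded {k₀} {k₁} {c₀} {c₁} (codedBase-amalgam base
        (codedEmb⁺ {j} {k₀} {c₀} same₀ , codedEmb⁺ {j} {k₁} {c₁} same₁))
      where
      decoded : ∀ {k₀ k₁} {c₀ : Vec (Elem k₀) (rank j)} {c₁ : Vec (Elem k₁) (rank j)} →
        ∃ (CodedAmalgam (𝕀 j) (𝕀 k₀ ⊗ ⟦ k₀ ∣ c₀ ⟧) (𝕀 k₁ ⊗ ⟦ k₁ ∣ c₁ ⟧)) → Amalgam {j} c₀ c₁
      decoded {k₀} {k₁} {c₀} {c₁} (v , amalgam) =
        proj₁ (codedAmalgam⁻ {j} {k₀} {k₁} {c₀} {c₁} {v} amalgam)

    -- Deciding membership in `AB`

    CodedAB : ℕ → Set
    CodedAB n = CodedEmb (π₁ n) (π₂ n) × CodedBase (π₁ (π₂ n))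

    codedAB⁺ : ∀ {n} → codes 𝕂 (AB 𝕂) n → CodedAB n
    codedAB⁺ (i , j , potEmb _ c , (isEmb same , base) , refl) =
      subst₂ (CodedEmb) (sym (π₁-⊗ (𝕀 i) r)) (sym (π₂-⊗ (𝕀 i) r)) (codedEmb⁺ {i} {j} {c} same) ,
      subst CodedBase (sym (trans (cong π₁ (π₂-⊗ (𝕀 i) r)) (π₁-⊗ (𝕀 j) ⟦ j ∣ c ⟧))) (codedBase⁺ base)
      where r = 𝕀 j ⊗ ⟦ j ∣ c ⟧

    -- `CodedEmb` alone makes `n` the code of an embedding; it yields the index `j` of the codomain,
    -- to which the second conjunct then applies.
    codedAB⁻ : ∀ {n} → CodedAB n → codes 𝕂 (AB 𝕂) n
    codedAB⁻ {n} (emb , base) = withDomain (codedEmb-domain emb)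
      where
      withDomain : ∃[ i ] π₁ n ≡ 𝕀 i → codes 𝕂 (AB 𝕂) n
      withDomain (i , n₁≡) =
        withCodomain (codedEmb-codomain {i} {π₂ n} (subst (λ x → CodedEmb x (π₂ n)) n₁≡ emb))
        where
        withCodomain :
          ∃[ j ] Σ[ c ∈ Vec (Elem j) (rank i) ] (π₂ n ≡ 𝕀 j ⊗ ⟦ j ∣ c ⟧ × Same i j (gens i) c) →
          codes 𝕂 (AB 𝕂) n
        withCodomain (j , c , n₂≡ , same) =
          i , j , potEmb (rank i) c ,
          (isEmb same ,
           codedBase⁻ (subst CodedBase (trans (cong π₁ n₂≡) (π₁-⊗ (𝕀 j) ⟦ j ∣ c ⟧)) base)) ,
          trans (cong₂ _⊗_ (sym n₁≡) (sym n₂≡)) (⊗-unpair n)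

    codedAB⇔ : ∀ n → CodedAB n ⇔ codes 𝕂 (AB 𝕂) n
    codedAB⇔ n = mk⇔ codedAB⁻ codedAB⁺

    EI≤T″ : O ≤T O ′ ′
    EI≤T″ = ≤T-trans (≤T-jump O) (≤T-jump (O ′))

    codedAB≤T : CodedAB ≤T O ′ ′
    codedAB≤T = ≤T-trans (codedEmbᵈ fstʳ sndʳ) EI≤T″ ×ᵈ codedBase≤T ∘ᵈ fstʳ ∘ʳ sndʳ

    -- The witness to (CAP)

    AB-distinguished : HasCAP K → IsDistinguished 𝕂 (AB 𝕂)
    AB-distinguished cap = record
      { embeddings  = proj₁
      ; pre-closed  = λ {_} {_} {_} {F} (_ , base) f σ _ → proj₂ (_∘ᴱ_ 𝕂 (F , f) σ) , base
      ; post-closed = λ {_} {_} {k} {F} (_ , base) f σ iso →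
          proj₂ (_∘ᴱ_ 𝕂 σ (F , f)) , base-≅ base (𝓢∈K k) (encoded 𝕂 (proj₂ σ) , iso)
      ; total       = λ i →
          -- The base given by (CAP) need not be listed, so it is replaced by an isomorphic `𝓢 j`,
          -- again a base.
          let B , base , g = cap (𝓢∈K i)
              j , δ , iso  = exhaustive (proj₁ base)
          in  j , potEmb (rank i) (map (to (δ ∘ᵉ g)) (gens i)) ,
              isEmb (embedding-preserves-type (δ ∘ᵉ g) (gens i)) , base-≅ base (𝓢∈K j) (δ , iso)
      }

    -- The length of the range is free in `PotEmb`; the code forces it to be `rank i`.
    codedEmb-isEmb : ∀ {i j} (F : PotEmb 𝕂 i j) →
      CodedEmb (𝕀 i) (𝕀 j ⊗ ⟦ j ∣ PotEmb.range F ⟧) → IsEmb 𝕂 F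
    codedEmb-isEmb {i} {j} (potEmb n c) emb =
      sameRange (codedEmb-range {i} {j} {⟦ j ∣ c ⟧} emb)
      where
      sameRange : Σ[ c′ ∈ Vec (Elem j) (rank i) ] (⟦ j ∣ c ⟧ ≡ ⟦ j ∣ c′ ⟧ × Same i j (gens i) c′) →
                  IsEmb 𝕂 (potEmb n c)
      sameRange (c′ , e , same) =
        subst (λ (n , c) → IsEmb 𝕂 (potEmb n c)) (sym (values-injective {𝓜 = 𝒜 j} c c′ e)) (isEmb same)

    amalgam-diagram : ∀ {j k₀ k₁} {c₀ : Vec (Elem k₀) (rank j)} {c₁ : Vec (Elem k₁) (rank j)}
      (A : Amalgam {j} c₀ c₁) →
      IsAmalgamationDiagram 𝕂 {j} (potEmb (rank j) c₀) (potEmb (rank j) c₁)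
        (potEmb (rank k₀) (Amalgam.d₀ A)) (potEmb (rank k₁) (Amalgam.d₁ A))
    amalgam-diagram {j} {k₀} {k₁} A = record
      { G₀-emb      = isEmb emb₀
      ; amalgamates = λ where
          (isEmb same₀) (isEmb same₁) → isEmb emb₁ ,
            amalgam-commutes A
              (extend (generated j) same₀) (extend (generated j) same₁)
              (extend (generated k₀) emb₀) (extend (generated k₁) emb₁)
              (extend-generators (generated j) same₀) (extend-generators (generated j) same₁)
              (extend-generators (generated k₀) emb₀) (extend-generators (generated k₁) emb₁)
      }
      where open Amalgam A

    trivial-diagram : ∀ {j k₀ k₁} {G₀ : PotEmb 𝕂 j k₀} {G₁ : PotEmb 𝕂 j k₁} →
      ¬ (IsEmb 𝕂 G₀ × IsEmb 𝕂 G₁) →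
      IsAmalgamationDiagram 𝕂 G₀ G₁ (potEmb (rank k₀) (gens k₀)) (potEmb {j = k₀} 0 [])
    trivial-diagram ¬span = record
      { G₀-emb      = isEmb λ φ → mk⇔ id id
      ; amalgamates = λ g₀ g₁ → contradiction (g₀ , g₁) ¬span
      }

    -- The codes of the two diagram maps, with common codomain `π₁ v` and ranges the last two
    -- components of `v`.
    amalgamOutput : ℕ → ℕ → ℕ → ℕ
    amalgamOutput r₀ r₁ v =
      (π₁ r₀ ⊗ π₁ v ⊗ π₁ (π₂ (π₂ v))) ⊗ (π₁ r₁ ⊗ π₁ v ⊗ π₂ (π₂ (π₂ v)))

    amalgamOutput-⊗ : ∀ x₀ t₀ x₁ t₁ q e d₀ d₁ →
      amalgamOutput (x₀ ⊗ t₀) (x₁ ⊗ t₁) (q ⊗ e ⊗ d₀ ⊗ d₁) ≡ (x₀ ⊗ q ⊗ d₀) ⊗ (x₁ ⊗ q ⊗ d₁)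
    amalgamOutput-⊗ x₀ t₀ x₁ t₁ q e d₀ d₁
      rewrite unpair-⊗ x₀ t₀ | unpair-⊗ x₁ t₁ | unpair-⊗ q (e ⊗ d₀ ⊗ d₁)
            | unpair-⊗ e (d₀ ⊗ d₁) | unpair-⊗ d₀ d₁ = refl

    -- `π₁ (π₁ r₀)` is the code of the generators of `π₁ r₀`, which gives the identity; 0 is the
    -- code of the empty tuple.
    trivialOutput : ℕ → ℕ → ℕ
    trivialOutput r₀ r₁ = (π₁ r₀ ⊗ π₁ r₀ ⊗ π₁ (π₁ r₀)) ⊗ (π₁ r₁ ⊗ π₁ r₀ ⊗ 0)

    trivialOutput-⊗ : ∀ x₀ t₀ x₁ t₁ →
      trivialOutput (x₀ ⊗ t₀) (x₁ ⊗ t₁) ≡ (x₀ ⊗ x₀ ⊗ π₁ x₀) ⊗ (x₁ ⊗ x₀ ⊗ 0)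
    trivialOutput-⊗ x₀ t₀ x₁ t₁ rewrite unpair-⊗ x₀ t₀ | unpair-⊗ x₁ t₁ = refl

    -- The input (F , G₀ , G₁) is coded as ⌜ F ⌝ ⊗ (base n ⊗ leg₀ n) ⊗ (base n ⊗ leg₁ n).
    base leg₀ leg₁ : ℕ → ℕ
    base n = π₁ (π₁ (π₂ n))
    leg₀ n = π₂ (π₁ (π₂ n))
    leg₁ n = π₂ (π₂ (π₂ n))

    input : ∀ x y r₀ r₁ → let n = x ⊗ (y ⊗ r₀) ⊗ (y ⊗ r₁) in base n ≡ y × leg₀ n ≡ r₀ × leg₁ n ≡ r₁
    input x y r₀ r₁
      rewrite unpair-⊗ x ((y ⊗ r₀) ⊗ (y ⊗ r₁)) | unpair-⊗ (y ⊗ r₀) (y ⊗ r₁)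
            | unpair-⊗ y r₀ | unpair-⊗ y r₁ = refl , refl , refl

    -- The projections of the input are parameters, so that matching on `refl` in `diagramᶜ-chosen`
    -- can replace them by the actual components.
    record Chosen (c : Code) (n y r₀ r₁ : ℕ) : Set where
      field
        on-span  : Span y r₀ r₁ → ∃ (CodedAmalgam y r₀ r₁) →
          ∃[ v ] (CodedAmalgam y r₀ r₁ v × O ⊢ c · n ↓ amalgamOutput r₀ r₁ v)
        off-span : ¬ Span y r₀ r₁ → O ⊢ c · n ↓ trivialOutput r₀ r₁

    diagramProgram : ∃[ c ] ∀ n → Chosen c n (base n) (leg₀ n) (leg₁ n)
    diagramProgram = let c , spec = chosen in c , λ n → record
      { on-span = proj₁ (spec n) ; off-span = proj₂ (spec n) }
      where
      baseʳ : Recursive O base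
      baseʳ = fstʳ ∘ʳ fstʳ ∘ʳ sndʳ

      leg₀ʳ : Recursive O leg₀
      leg₀ʳ = sndʳ ∘ʳ fstʳ ∘ʳ sndʳ

      leg₁ʳ : Recursive O leg₁
      leg₁ʳ = sndʳ ∘ʳ sndʳ ∘ʳ sndʳ

      chosen = choose (λ n → Span (base n) (leg₀ n) (leg₁ n))
        (λ n → CodedAmalgam (base n) (leg₀ n) (leg₁ n))
        {λ n → amalgamOutput (leg₀ n) (leg₁ n)} {λ n → trivialOutput (leg₀ n) (leg₁ n)}
        (spanᵈ baseʳ leg₀ʳ leg₁ʳ)
        (codedAmalgamᵈ (baseʳ ∘ʳ fstʳ) (leg₀ʳ ∘ʳ fstʳ) (leg₁ʳ ∘ʳ fstʳ) sndʳ)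
        (((fstʳ ∘ʳ leg₀ʳ ∘ʳ fstʳ) ⊗ʳ (fstʳ ∘ʳ sndʳ) ⊗ʳ (fstʳ ∘ʳ sndʳ ∘ʳ sndʳ ∘ʳ sndʳ)) ⊗ʳ
         ((fstʳ ∘ʳ leg₁ʳ ∘ʳ fstʳ) ⊗ʳ (fstʳ ∘ʳ sndʳ) ⊗ʳ (sndʳ ∘ʳ sndʳ ∘ʳ sndʳ ∘ʳ sndʳ)))
        (((fstʳ ∘ʳ leg₀ʳ) ⊗ʳ (fstʳ ∘ʳ leg₀ʳ) ⊗ʳ (fstʳ ∘ʳ fstʳ ∘ʳ leg₀ʳ)) ⊗ʳ
         ((fstʳ ∘ʳ leg₁ʳ) ⊗ʳ (fstʳ ∘ʳ leg₀ʳ) ⊗ʳ constʳ 0))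

    diagramᶜ : Code
    diagramᶜ = proj₁ diagramProgram

    diagramᶜ-chosen : ∀ x y r₀ r₁ → Chosen diagramᶜ (x ⊗ (y ⊗ r₀) ⊗ (y ⊗ r₁)) y r₀ r₁
    diagramᶜ-chosen x y r₀ r₁ = along _ (input x y r₀ r₁)
      where
      along : ∀ n → base n ≡ y × leg₀ n ≡ r₀ × leg₁ n ≡ r₁ → Chosen diagramᶜ n y r₀ r₁
      along n (refl , refl , refl) = proj₂ diagramProgram n

    DiagramAt : ∀ {j k₀ k₁} → Pred ℕ 0ℓ → Code → ℕ → PotEmb 𝕂 j k₀ → PotEmb 𝕂 j k₁ → Set
    DiagramAt {j} {k₀} {k₁} S c n G₀ G₁ = ∃[ l ] Σ[ H₀ ∈ PotEmb 𝕂 k₀ l ] Σ[ H₁ ∈ PotEmb 𝕂 k₁ l ]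
      (IsAmalgamationDiagram 𝕂 G₀ G₁ H₀ H₁ × S ⊢ c · n ↓ (⌜_⌝ᴱ 𝕂 H₀ ⊗ ⌜_⌝ᴱ 𝕂 H₁))

    relativise : ∀ {S o c n j k₀ k₁} {G₀ : PotEmb 𝕂 j k₀} {G₁ : PotEmb 𝕂 j k₁} → Decides S o O →
      DiagramAt O c n G₀ G₁ → DiagramAt S (withOracle o c) n G₀ G₁
    relativise {o = o} {c} decides (l , H₀ , H₁ , d , halts) =
      l , H₀ , H₁ , d , withOracle-↓ {o = o} decides c halts

    module _ {j k₀ k₁ : ℕ} (isBase : IsAmalgamationBase K (𝓢 j)) where

      -- Being a base guarantees that the search meets an amalgam; whichever one it finds decodes to
      -- a diagram.
      diagram-on : ∀ n {G₀ : PotEmb 𝕂 j k₀} {G₁ : PotEmb 𝕂 j k₁} →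
        Chosen diagramᶜ n (𝕀 j) (𝕀 k₀ ⊗ ⟦ k₀ ∣ PotEmb.range G₀ ⟧) (𝕀 k₁ ⊗ ⟦ k₁ ∣ PotEmb.range G₁ ⟧) →
        IsEmb 𝕂 G₀ → IsEmb 𝕂 G₁ → DiagramAt O diagramᶜ n G₀ G₁
      diagram-on n chosen (isEmb {c₀} same₀) (isEmb {c₁} same₁) =
        found (Chosen.on-span chosen span (base-codedAmalgam {j} {r₀} {r₁} isBase span))
        where
        r₀ = 𝕀 k₀ ⊗ ⟦ k₀ ∣ c₀ ⟧
        r₁ = 𝕀 k₁ ⊗ ⟦ k₁ ∣ c₁ ⟧

        span : Span (𝕀 j) r₀ r₁
        span = codedEmb⁺ {j} {k₀} {c₀} same₀ , codedEmb⁺ {j} {k₁} {c₁} same₁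

        decoded : ∀ {v} → Σ[ A ∈ Amalgam {j} c₀ c₁ ] v ≡ Amalgam.code A →
          O ⊢ diagramᶜ · n ↓ amalgamOutput r₀ r₁ v →
          DiagramAt O diagramᶜ n (potEmb (rank j) c₀) (potEmb (rank j) c₁)
        decoded (A , v≡) halts =
          l , potEmb (rank k₀) d₀ , potEmb (rank k₁) d₁ , amalgam-diagram {j} A ,
          subst (O ⊢ diagramᶜ · n ↓_)
            (trans (cong (amalgamOutput r₀ r₁) v≡)
              (amalgamOutput-⊗ (𝕀 k₀) ⟦ k₀ ∣ c₀ ⟧ (𝕀 k₁) ⟦ k₁ ∣ c₁ ⟧
                (𝕀 l) ⟦ l ∣ e ⟧ ⟦ l ∣ d₀ ⟧ ⟦ l ∣ d₁ ⟧))
            halts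
          where open Amalgam A

        found : ∃[ v ] (CodedAmalgam (𝕀 j) r₀ r₁ v × O ⊢ diagramᶜ · n ↓ amalgamOutput r₀ r₁ v) →
          DiagramAt O diagramᶜ n (potEmb (rank j) c₀) (potEmb (rank j) c₁)
        found (v , amalgam , halts) =
          decoded {v} (codedAmalgam⁻ {j} {k₀} {k₁} {c₀} {c₁} {v} amalgam) halts

      diagram-off : ∀ n (G₀ : PotEmb 𝕂 j k₀) (G₁ : PotEmb 𝕂 j k₁) →
        Chosen diagramᶜ n (𝕀 j) (𝕀 k₀ ⊗ ⟦ k₀ ∣ PotEmb.range G₀ ⟧) (𝕀 k₁ ⊗ ⟦ k₁ ∣ PotEmb.range G₁ ⟧) →
        ¬ (IsEmb 𝕂 G₀ × IsEmb 𝕂 G₁) → DiagramAt O diagramᶜ n G₀ G₁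
      diagram-off n G₀ G₁ chosen ¬span =
        k₀ , potEmb (rank k₀) (gens k₀) , potEmb 0 [] , trivial-diagram ¬span ,
        subst (O ⊢ diagramᶜ · n ↓_)
          (trans (trivialOutput-⊗ (𝕀 k₀) t₀ (𝕀 k₁) t₁)
            (cong (λ t → (𝕀 k₀ ⊗ 𝕀 k₀ ⊗ t) ⊗ (𝕀 k₁ ⊗ 𝕀 k₀ ⊗ 0)) (π₁-𝕀 k₀)))
          (Chosen.off-span chosen λ (emb₀ , emb₁) →
            ¬span (codedEmb-isEmb G₀ emb₀ , codedEmb-isEmb G₁ emb₁))
        where
        t₀ = ⟦ k₀ ∣ PotEmb.range G₀ ⟧
        t₁ = ⟦ k₁ ∣ PotEmb.range G₁ ⟧

      diagram : ∀ x (G₀ : PotEmb 𝕂 j k₀) (G₁ : PotEmb 𝕂 j k₁) →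
        DiagramAt O diagramᶜ (x ⊗ ⌜_⌝ᴱ 𝕂 G₀ ⊗ ⌜_⌝ᴱ 𝕂 G₁) G₀ G₁
      diagram x G₀ G₁ = byCases em
        where
        n = x ⊗ ⌜_⌝ᴱ 𝕂 G₀ ⊗ ⌜_⌝ᴱ 𝕂 G₁

        chosen : Chosen diagramᶜ n (𝕀 j) (𝕀 k₀ ⊗ ⟦ k₀ ∣ PotEmb.range G₀ ⟧)
                                         (𝕀 k₁ ⊗ ⟦ k₁ ∣ PotEmb.range G₁ ⟧)
        chosen = diagramᶜ-chosen x (𝕀 j) (𝕀 k₀ ⊗ ⟦ k₀ ∣ PotEmb.range G₀ ⟧)
                                         (𝕀 k₁ ⊗ ⟦ k₁ ∣ PotEmb.range G₁ ⟧)

        byCases : Dec (IsEmb 𝕂 G₀ × IsEmb 𝕂 G₁) → DiagramAt O diagramᶜ n G₀ G₁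
        byCases (yes (g₀ , g₁)) = diagram-on n chosen g₀ g₁
        byCases (no ¬span)      = diagram-off n G₀ G₁ chosen ¬span

    programFunction : Pred ℕ 0ℓ → Code → PartialFunction
    programFunction S c = record { graph = λ n v → S ⊢ c · n ↓ v ; functional = deterministic c }

    cCAP : ∀ {S} → O ≤T S → CodedAB ≤T S → HasCAP K → _-cCAP 𝕂 S
    cCAP {S} (o , decides) codedAB≤S cap = record
      { AB₀           = AB 𝕂
      ; distinguished = AB-distinguished cap
      ; bases         = proj₂
      ; f             = programFunction S (withOracle o diagramᶜ)
      ; amalgamates   = λ {_} {_} {_} {_} {F} (_ , isBase) G₀ G₁ →
          relativise {o = o} {diagramᶜ} decides (diagram isBase (⌜_⌝ᴱ 𝕂 F) G₀ G₁)
      } ,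
      CE-cast codedAB⇔ (≤T⇒CE codedAB≤S) , withOracle o diagramᶜ , λ n v → mk⇔ id id

theorem5p36 : ExcludedMiddle (lsuc 0ℓ) → (L : Language) (𝕂 : ComputableAge L) →
    (codes 𝕂 (AB 𝕂) ≤T EI 𝕂 ′ ′) × (HasCAP (ComputableAge.K 𝕂) → _-cCAP 𝕂 (EI 𝕂 ′ ′))
theorem5p36 em L 𝕂 = ≤T-cast (codedAB⇔ 𝕂 em₀) (codedAB≤T 𝕂 em₀) , cCAP 𝕂 em₀ (EI≤T″ 𝕂 em₀) (codedAB≤T 𝕂 em₀)
  where
  em₀ : ExcludedMiddle 0ℓ
  em₀ = map′ lower lift em
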